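{- Let $t\ge 2$ and $n\ge 1$ be integers, let $\omega$ be a primitive $t$-th root of unity and let $X=(x_1,\dots,x_n)$ be indeterminates. Let $\lambda$ be a partition with $\ell(\lambda)\le tn+1$, and write $n_i=n_i(\lambda,tn+1)$ and $\lambda^{(i)}$ ($0\le i\le t-1$) for the beta-set data and the $t$-quotient computed with $m=tn+1$ (see context). Consider the Schur polynomial $s_\lambda$ in the $tn+1$ variables $(X,\omega X,\dots,\omega^{t-1}X,1)=(x_1,\dots,x_n,\omega x_1,\dots,\omega x_n,\dots,\omega^{t-1}x_1,\dots,\omega^{t-1}x_n,1)$. (1) If the $t$-core of $\lambda$ has length greater than $1$, then $s_\lambda(X,\omega X,\dots,\omega^{t-1}X,1)=0$. (2) If the $t$-core of $\lambda$ equals the one-row partition $(c)$ for some $0\le c\le t-1$ (with $(0)$ the empty partition), then \[ s_\lambda(X,\omega X,\dots,\omega^{t-1}X,1)=(-1)^{\frac{t(t-1)}{2}\frac{n(n+1)}{2}-cn}\,\operatorname{sgn}(\sigma^c_\lambda)\, s_{\lambda^{(c)}}(x_1^t,\dots,x_n^t,1)\prod_{i\ne c,\,0\le i\le t-1} s_{\lambda^{(i)}}(x_1^t,\dots,x_n^t). \]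
   Context: For a sequence $\mu=(\mu_1,\dots,\mu_N)$ of nonnegative integers with $\mu_1\ge\dots\ge\mu_N$, the Schur polynomial in $N$ variables is $s_\mu(y_1,\dots,y_N)=\det(y_i^{\mu_j+N-j})_{i,j=1}^N/\det(y_i^{N-j})_{i,j=1}^N$ (for a partition with fewer than $N$ nonzero parts, pad with zeros). For a partition $\lambda$ with $\ell(\lambda)\le m$, its beta set is $\beta(\lambda,m)=(\beta_1,\dots,\beta_m)$ with $\beta_j=\lambda_j+m-j$. For $0\le i\le t-1$, $n_i(\lambda,m)$ is the number of entries of $\beta(\lambda,m)$ congruent to $i$ modulo $t$. The entries congruent to $i$ are written in decreasing order as $t\tilde\beta^{(i)}_1+i>\dots>t\tilde\beta^{(i)}_{n_i}+i$, and $\lambda^{(i)}$ is the partition with $n_i(\lambda,m)$ parts (some possibly zero) given by $\lambda^{(i)}_j=\tilde\beta^{(i)}_j-n_i(\lambda,m)+j$; the $t$-quotient is $(\lambda^{(0)},\dots,\lambda^{(t-1)})$. The $t$-core of $\lambda$ is the partition obtained by successively removing border strips (connected skew shapes containing no $2\times2$ square) of size $t$ from the Young diagram of $\lambda$ until no more can be removed; it is independent of choices. The permutation $\sigma^c_\lambda\in S_{tn+1}$ is defined by requiring that $(\beta_{\sigma^c_\lambda(1)},\dots,\beta_{\sigma^c_\lambda(tn+1)})$ (with $\beta=\beta(\lambda,tn+1)$) lists first the $n_c$ entries congruent to $c$ mod $t$ in decreasing order, then the entries congruent to $0$ in decreasing order, then those congruent to $1$, and so on up to $t-1$, skipping the residue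 $c$. -}

module Defs where

open import Level using (Level; _⊔_) renaming (suc to lsuc)
open import Algebra.Bundles using (CommutativeRing)
open import Data.Bool using (Bool; true; false; if_then_else_; not)
open import Data.Nat using (ℕ; zero; suc; _+_; _*_; _∸_; _≤_; _<_; _≡ᵇ_; _<ᵇ_; NonZero)
open import Data.Nat.DivMod using (_%_; _/_)
open import Data.List using (List; []; _∷_; _++_; length; map; zipWith; upTo; downFrom; take; replicate; concatMap; foldr)
open import Data.Fin using (Fin)
open import Data.Nat.ListAction using (sum)
open import Data.List using () renaming (allFin to allFinL)
open import Data.Product using (_×_)
open import Relation.Binary.PropositionalEquality using (_≡_)
open import Relation.Nullary using (¬_)

-- Fields (not in agda-stdlib): a commutative ring with 0 ≠ 1 in which
-- every nonzero element has an inverse.  The inverse is a total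
-- function whose value at 0 is unspecified (never used).

record Field (c ℓ : Level) : Set (lsuc (c ⊔ ℓ)) where
  field
    commutativeRing : CommutativeRing c ℓ
  open CommutativeRing commutativeRing public
    hiding (_*_)
  open CommutativeRing commutativeRing public
    using () renaming (_*_ to _·_)
  field
    _⁻¹        : Carrier → Carrier
    0≉1        : ¬ (0# ≈ 1#)
    ⁻¹-inverse : ∀ x → ¬ (x ≈ 0#) → (x · (x ⁻¹)) ≈ 1#

keep : ∀ {a} {A : Set a} → (A → Bool) → List A → List A
keep p [] = []
keep p (x ∷ xs) = if p x then x ∷ keep p xs else keep p xs

-- entry i of a list of naturals, 0 beyond the end (partitions padded by 0)
at : List ℕ → ℕ → ℕ
at [] i = 0
at (x ∷ xs) zero = x
at (x ∷ xs) (suc i) = at xs i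

dropAt : ∀ {a} {A : Set a} → ℕ → List A → List A
dropAt i [] = []
dropAt zero (x ∷ xs) = xs
dropAt (suc i) (x ∷ xs) = x ∷ dropAt i xs

pad : ℕ → List ℕ → List ℕ
pad N μ = take N (μ ++ replicate N 0)

-- Partitions (as weakly decreasing lists, possibly with trailing zeros)

Decreasing : List ℕ → Set
Decreasing [] = Data.Unit.⊤
  where import Data.Unit
Decreasing (a ∷ []) = Data.Unit.⊤
  where import Data.Unit
Decreasing (a ∷ b ∷ l) = b ≤ a × Decreasing (b ∷ l)

partLength : List ℕ → ℕ
partLength l = length (keep (λ a → 0 <ᵇ a) l)

-- μ is obtained from λ (same padded length) by removing a border strip of
-- size t: λ/μ is a skew shape of size t which contains no 2×2 square and
-- is connected.  Row i of λ/μ consists of the columns at μ i < j ≤ at λ i.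
RemovesStrip : ℕ → List ℕ → List ℕ → Set
RemovesStrip t lam mu =
    length mu ≡ length lam
  × Decreasing mu
  × (∀ i → at mu i ≤ at lam i)
  × sum lam ≡ sum mu + t
  -- no 2×2 square: rows i, i+1 share at most one column
  × (∀ i → at lam (suc i) ≤ suc (at mu i))
  -- connected: the nonempty rows form an interval ...
  × (∀ i j k → i ≤ j → j ≤ k → at mu i < at lam i → at mu k < at lam k
       → at mu j < at lam j)
  -- ... and consecutive nonempty rows share an edge
  × (∀ i → at mu i < at lam i → at mu (suc i) < at lam (suc i)
       → at mu i < at lam (suc i))

data Reach (t : ℕ) : List ℕ → List ℕ → Set where
  done : ∀ {lam} → Reach t lam lam
  step : ∀ {lam mu nu} → RemovesStrip t lam mu → Reach t mu nu → Reach t lam nu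

IsCore : ℕ → List ℕ → List ℕ → Set
IsCore t lam kappa = Reach t lam kappa × (∀ mu → ¬ RemovesStrip t kappa mu)

-- β(λ, m) with m = length of the (padded) list: β_j = λ_j + m - j
beta : List ℕ → List ℕ
beta lam = zipWith _+_ lam (downFrom (length lam))

betaRes : (t : ℕ) → .{{NonZero t}} → ℕ → List ℕ → List ℕ
betaRes t i lam = keep (λ b → (b % t) ≡ᵇ i) (beta lam)

nRes : (t : ℕ) → .{{NonZero t}} → ℕ → List ℕ → ℕ
nRes t i lam = length (betaRes t i lam)

-- λ^{(i)}: λ^{(i)}_j = β̃_j - n_i + j   (j 1-based; here j 0-based gives +1)
quotient : (t : ℕ) → .{{NonZero t}} → ℕ → List ℕ → List ℕ
quotient t i lam =
  zipWith (λ bt j → (bt + suc j) ∸ nRes t i lam)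
          (map (λ b → b / t) (betaRes t i lam))
          (upTo (nRes t i lam))

posRes : (t : ℕ) → .{{NonZero t}} → ℕ → List ℕ → List ℕ
posRes t i lam =
  keep (λ j → (at (beta lam) j % t) ≡ᵇ i) (upTo (length lam))

-- the one-line notation (σ(1), …, σ(m)) of σ^c_λ (0-based values)
sigmaList : (t : ℕ) → .{{NonZero t}} → ℕ → List ℕ → List ℕ
sigmaList t c lam =
  posRes t c lam ++
  concatMap (λ i → posRes t i lam) (keep (λ i → not (i ≡ᵇ c)) (upTo t))

inversions : List ℕ → ℕ
inversions [] = 0
inversions (a ∷ l) = length (keep (λ b → b <ᵇ a) l) + inversions l

module FieldOps {c ℓ} (F : Field c ℓ) where
  open Field F public renaming (_+_ to _⊕_)

  _^_ : Carrier → ℕ → Carrier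
  x ^ zero = 1#
  x ^ suc k = x · (x ^ k)

  sgnPow : ℕ → Carrier
  sgnPow k = (- 1#) ^ k

  sgn : List ℕ → Carrier
  sgn σ = sgnPow (inversions σ)

  mutual
    detN : ℕ → List (List Carrier) → Carrier
    detN zero _ = 1#
    detN (suc k) [] = 1#
    detN (suc k) (r ∷ rs) = expand k 0 r rs

    expand : ℕ → ℕ → List Carrier → List (List Carrier) → Carrier
    expand k j [] rs = 0#
    expand k j (a ∷ r) rs =
      ((sgnPow j · a) · detN k (map (dropAt j) rs)) ⊕ expand k (suc j) r rs

  det : List (List Carrier) → Carrier
  det M = detN (length M) M

  alternant : List Carrier → List ℕ → Carrier
  alternant ys μ =
    det (map (λ y → map (λ e → y ^ e)
                        (zipWith _+_ (pad (length ys) μ) (downFrom (length ys))))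
             ys)

  schur : List Carrier → List ℕ → Carrier
  schur ys μ = alternant ys μ · (alternant ys [] ⁻¹)

  prod : List Carrier → Carrier
  prod = foldr _·_ 1#

  Primitive : ℕ → Carrier → Set ℓ
  Primitive t ω = (ω ^ t ≈ 1#) × (∀ k → 1 ≤ k → k < t → ¬ (ω ^ k ≈ 1#))

  spec : (t n : ℕ) → Carrier → (Fin n → Carrier) → List Carrier
  spec t n ω x = concatMap (λ a → map (λ b → (ω ^ a) · x b) (allFinL n)) (upTo t) ++ (1# ∷ [])

  powVars : (t n : ℕ) → (Fin n → Carrier) → List Carrier
  powVars t n x = map (λ b → x b ^ t) (allFinL n)

{-# OPTIONS --safe #-}
module Submission where

open import Defs
open import Level using (Level)
open import Data.Nat as ℕ using (ℕ; zero; suc; _+_; _*_; _∸_; _/_; _%_; _≤_; _<_; _≡ᵇ_; _<ᵇ_; NonZero; z≤n; s≤s)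
import Data.Nat.Properties as ℕ
import Data.Nat.DivMod as ℕ
open import Data.Nat.ListAction using (sum)
open import Data.Nat.Tactic.RingSolver using (solve-∀)
open import Data.List using (List; []; _∷_; _++_; map; foldr; applyUpTo; upTo; downFrom; replicate; take; length; concatMap; zipWith; allFin; cartesianProduct)
import Data.List.Properties as List
open import Data.List.Relation.Unary.All as All using (All; []; _∷_)
import Data.List.Relation.Unary.All.Properties as All
open import Data.List.Relation.Unary.Any using (here; there)
open import Data.List.Relation.Unary.AllPairs as AllPairs using (AllPairs; []; _∷_)
import Data.List.Relation.Unary.AllPairs.Properties as AllPairs
open import Data.List.Relation.Unary.Unique.Propositional using (Unique)
import Data.List.Relation.Unary.Unique.Propositional.Properties as Unique
open import Data.List.Membership.Propositional using (_∈_; _∉_)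
open import Data.List.Membership.Propositional.Properties using (∈-∃++; ∈-map⁺; ∈-map⁻; ∈-upTo⁻; ∈-upTo⁺; ∈-allFin; ∈-cartesianProduct⁺; ∈-cartesianProduct⁻)
open import Data.List.Membership.DecPropositional ℕ._≟_ using (_∈?_)
open import Data.List.Relation.Binary.Permutation.Propositional using (_↭_; ↭-sym; ↭-trans; ↭-refl; ↭-reflexive; prep; swap)
import Data.List.Relation.Binary.Permutation.Propositional.Properties as Perm
open import Data.Fin using (Fin)
import Data.Fin as Fin
open import Data.Bool using (Bool; true; false; not; if_then_else_; T; _∨_)
open import Data.Product using (_×_; ∃; _,_; proj₁; proj₂)
open import Data.Unit using (tt)
open import Data.Empty using (⊥-elim)
open import Function using (_∘_; id)
open import Relation.Binary.PropositionalEquality as ≡ using (_≡_; _≢_; cong; subst)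
open import Relation.Binary.Definitions using (tri<; tri≈; tri>)
open import Relation.Nullary using (¬_; yes; no; does; contradiction)

-- Let a row be a function of the column exponent e ∈ β(λ).  The row of the
-- variable ω^a x_b is e ↦ ω^(ae) x_b^e = Σ_i ω^(ai) [e ≡ i mod t] x_b^e, so
-- the alternant of λ in (X, ωX, …, ω^(t-1)X, 1) is a constant, independent of
-- λ, times the determinant whose rows are e ↦ [e ≡ i mod t] x_b^e and e ↦ 1.
-- Since the constant also occurs in the Vandermonde determinant in the
-- denominator, it cancels.
--
-- The columns with residue i see only the n rows of that residue and the row
-- of ones.  Removing a border strip of size t lowers one beta number by t, so
-- the number n_i of columns with residue i depends only on the core, and the
-- beta numbers of a core are flush on each residue.  If the core has two
-- nonzero rows, two of its beta numbers are ≥ tn, so that either some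
-- n_i ≥ n + 2 or two of the n_i are ≥ n + 1; both make the determinant vanish.
-- If the core is (c), sorting the columns by σ^c_λ makes the matrix block
-- triangular, the diagonal blocks being alternants in x_1^t, …, x_n^t (and 1)
-- of the quotients; the case λ = ∅, c = 0 evaluates the denominator.

-- A determinant is a functional of two lists, its rows and its columns, each of which is rearranged
-- on its own. Every sign is then the cost of moving list entries past one another, apart from
-- `sgn (sigmaList t c lam)`, which counts inversions. The exponent in the formula has these
-- sources. For λ, the n rows of residue c pass the cn rows of smaller residue, at cost cn·n, which
-- has the parity of cn. For ∅, sorting the columns costs C(t,2)(1 + ... + n). In both, the row of
-- ones passes (t-1)n rows, so this contribution cancels, as do the monomials split off from the
-- rows. The indeterminates are elements of an arbitrary field subject to three conditions: `x i`
-- nonzero, distinct t-th powers, no t-th power equal to 1. These make the variables of each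
-- alternant distinct, so that all Vandermonde denominators are invertible. Since the characteristic
-- may be 2, the vanishing of a determinant with two equal rows cannot be read off from its change
-- of sign and is carried as a separate property.

module Combinatorics where
  open ≡ using (refl; sym; trans)

  -- Lists: fibres, counting and inversions

  concatMap-cong-local : ∀ {a b} {A : Set a} {B : Set b} {f g : A → List B} {L} →
    All (λ i → f i ≡ g i) L → concatMap f L ≡ concatMap g L
  concatMap-cong-local [] = refl
  concatMap-cong-local (eq ∷ eqs) = ≡.cong₂ _++_ eq (concatMap-cong-local eqs)

  length-concatMap : ∀ {a b} {A : Set a} {B : Set b} {f : A → List B} {k L} → All (λ i → length (f i) ≡ k) L →
    length (concatMap f L) ≡ length L * k
  length-concatMap [] = refl
  length-concatMap {f = f} (eq ∷ eqs) = trans (List.length-++ (f _)) (≡.cong₂ _+_ eq (length-concatMap eqs))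

  concatMap-[] : ∀ {a b} {A : Set a} {B : Set b} (L : List A) → concatMap {B = B} (λ _ → []) L ≡ []
  concatMap-[] [] = refl
  concatMap-[] (_ ∷ L) = concatMap-[] L

  map-cartesianProduct : ∀ {a b c} {A : Set a} {B : Set b} {C : Set c} (f : A × B → C) L M →
    map f (cartesianProduct L M) ≡ concatMap (λ i → map (λ j → f (i , j)) M) L
  map-cartesianProduct f [] M = refl
  map-cartesianProduct f (i ∷ L) M = trans (List.map-++ f (map (i ,_) M) _)
    (≡.cong₂ _++_ (sym (List.map-∘ M)) (map-cartesianProduct f L M))

  Unique⇒AllPairs : ∀ {a r} {A : Set a} {R : A → A → Set r} {L} → Unique L →
    (∀ {i j} → i ∈ L → j ∈ L → i ≢ j → R i j) → AllPairs R L
  Unique⇒AllPairs [] _ = []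
  Unique⇒AllPairs (i∉L ∷ uL) r =
    All.tabulate (λ j∈L → r (here refl) (there j∈L) (All.lookup i∉L j∈L)) ∷
    Unique⇒AllPairs uL (λ i∈ j∈ → r (there i∈) (there j∈))

  -- The binomial coefficient C(k,2), in the recursive form in which `interleave` accumulates its
  -- sign.
  triangle : ℕ → ℕ
  triangle zero = 0
  triangle (suc k) = k + triangle k

  triangle-*2 : ∀ k → triangle (suc k) * 2 ≡ suc k * k
  triangle-*2 zero = refl
  triangle-*2 (suc k) = trans (ℕ.*-distribʳ-+ 2 (suc k) (triangle (suc k)))
    (trans (cong (suc k * 2 +_) (triangle-*2 k)) (rearrange k))
    where
    rearrange : ∀ k → suc k * 2 + suc k * k ≡ suc (suc k) * suc k
    rearrange = solve-∀

  triangle-/2 : ∀ k → (suc k * k) / 2 ≡ triangle (suc k)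
  triangle-/2 k = trans (cong (_/ 2) (sym (triangle-*2 k))) (ℕ.m*n/n≡m (triangle (suc k)) 2)

  keep-++ : ∀ {a} {A : Set a} (p : A → Bool) k l → keep p (k ++ l) ≡ keep p k ++ keep p l
  keep-++ p [] l = refl
  keep-++ p (c ∷ k) l with p c
  ... | true = cong (c ∷_) (keep-++ p k l)
  ... | false = keep-++ p k l

  keep-map : ∀ {a b} {A : Set a} {B : Set b} (p : B → Bool) (f : A → B) l → keep p (map f l) ≡ map f (keep (p ∘ f) l)
  keep-map p f [] = refl
  keep-map p f (x ∷ l) with p (f x)
  ... | true = cong (f x ∷_) (keep-map p f l)
  ... | false = keep-map p f l

  keep-↭ : ∀ {a} {A : Set a} (p : A → Bool) {k l} → k ↭ l → keep p k ↭ keep p l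
  keep-↭ p _↭_.refl = ↭-refl
  keep-↭ p (prep x k↭l) with p x
  ... | true = prep x (keep-↭ p k↭l)
  ... | false = keep-↭ p k↭l
  keep-↭ p (swap x y k↭l) with p x | p y
  ... | true | true = swap x y (keep-↭ p k↭l)
  ... | true | false = prep x (keep-↭ p k↭l)
  ... | false | true = prep y (keep-↭ p k↭l)
  ... | false | false = keep-↭ p k↭l
  keep-↭ p (_↭_.trans k↭l l↭m) = ↭-trans (keep-↭ p k↭l) (keep-↭ p l↭m)

  ∈-keep⁺ : ∀ {a} {A : Set a} (p : A → Bool) {x l} → x ∈ l → p x ≡ true → x ∈ keep p l
  ∈-keep⁺ p (here refl) px rewrite px = here refl
  ∈-keep⁺ p {l = y ∷ _} (there x∈l) px with p y
  ... | true = there (∈-keep⁺ p x∈l px)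
  ... | false = ∈-keep⁺ p x∈l px

  All-keep⁺ : ∀ {a q} {A : Set a} {Q : A → Set q} (p : A → Bool) {l} → All Q l → All Q (keep p l)
  All-keep⁺ p [] = []
  All-keep⁺ p {x ∷ l} (qx ∷ ql) with p x
  ... | true = qx ∷ All-keep⁺ p ql
  ... | false = All-keep⁺ p ql

  keep-satisfies : ∀ {a} {A : Set a} (p : A → Bool) l → All (λ x → p x ≡ true) (keep p l)
  keep-satisfies p [] = []
  keep-satisfies p (x ∷ l) with p x in eq
  ... | true = eq ∷ keep-satisfies p l
  ... | false = keep-satisfies p l

  AllPairs-keep⁺ : ∀ {a r} {A : Set a} {R : A → A → Set r} (p : A → Bool) {l} → AllPairs R l → AllPairs R (keep p l)
  AllPairs-keep⁺ p [] = []
  AllPairs-keep⁺ p {x ∷ l} (rx ∷ rl) with p x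
  ... | true = All-keep⁺ p rx ∷ AllPairs-keep⁺ p rl
  ... | false = AllPairs-keep⁺ p rl

  unique-⊆⇒length≤ : ∀ {a} {A : Set a} {xs ys : List A} → Unique xs → (∀ {x} → x ∈ xs → x ∈ ys) → length xs ≤ length ys
  unique-⊆⇒length≤ [] _ = z≤n
  unique-⊆⇒length≤ {xs = x ∷ xs} (x∉xs ∷ uxs) ⊆ys with p , q , refl ← ∈-∃++ (⊆ys (here refl)) =
    ℕ.≤-trans (s≤s (unique-⊆⇒length≤ uxs ⊆pq)) (ℕ.≤-reflexive (sym (Perm.↭-length (Perm.shift x p q))))
    where
    ⊆pq : ∀ {y} → y ∈ xs → y ∈ p ++ q
    ⊆pq y∈xs with Perm.∈-resp-↭ (Perm.shift x p q) (⊆ys (there y∈xs))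
    ... | here refl = ⊥-elim (All.lookup x∉xs y∈xs refl)
    ... | there y∈ = y∈

  ≡ᵇ-true : ∀ {m n} → m ≡ n → (m ≡ᵇ n) ≡ true
  ≡ᵇ-true {zero} refl = refl
  ≡ᵇ-true {suc m} refl = ≡ᵇ-true {m} refl

  ≡ᵇ-false : ∀ {m n} → m ≢ n → (m ≡ᵇ n) ≡ false
  ≡ᵇ-false {m} {n} m≢n with m ≡ᵇ n in eq
  ... | false = refl
  ... | true = ⊥-elim (m≢n (ℕ.≡ᵇ⇒≡ m n (subst T (sym eq) tt)))

  ≡ᵇ-true⁻ : ∀ {m n} → (m ≡ᵇ n) ≡ true → m ≡ n
  ≡ᵇ-true⁻ {m} {n} eq = ℕ.≡ᵇ⇒≡ m n (subst T (sym eq) tt)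

  count : ∀ {a} {E : Set a} → (E → Bool) → List E → ℕ
  count Z l = length (keep Z l)

  count-true : ∀ {a} {E : Set a} (Z : E → Bool) {c} l → Z c ≡ true → count Z (c ∷ l) ≡ suc (count Z l)
  count-true Z l eq rewrite eq = refl

  count-false : ∀ {a} {E : Set a} (Z : E → Bool) {c} l → Z c ≡ false → count Z (c ∷ l) ≡ count Z l
  count-false Z l eq rewrite eq = refl

  count-∨ : ∀ {a} {E : Set a} (p q : E → Bool) l → (∀ i → p i ≡ true → q i ≡ false) → count (λ i → p i ∨ q i) l ≡ count p l + count q l
  count-∨ p q [] disjoint = refl
  count-∨ p q (i ∷ l) disjoint with p i in pi | q i in qi
  ... | true | true with () ← trans (sym qi) (disjoint i pi)
  ... | true | false = cong suc (count-∨ p q l disjoint)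
  ... | false | true = trans (cong suc (count-∨ p q l disjoint)) (sym (ℕ.+-suc _ _))
  ... | false | false = count-∨ p q l disjoint

  keep-<ᵇ-none : ∀ {u q} → All (u <_) q → length (keep (_<ᵇ u) q) ≡ 0
  keep-<ᵇ-none [] = refl
  keep-<ᵇ-none {u} {y ∷ _} (u<y ∷ u<q) with y <ᵇ u in eq
  ... | true = ⊥-elim (ℕ.<-asym u<y (ℕ.<ᵇ⇒< y u (subst T (sym eq) _)))
  ... | false = keep-<ᵇ-none u<q

  keep-<ᵇ-insert : ∀ {u x} → u < x → ∀ p q →
    length (keep (_<ᵇ x) (p ++ u ∷ q)) ≡ suc (length (keep (_<ᵇ x) (p ++ q)))
  keep-<ᵇ-insert {u} {x} u<x [] q with u <ᵇ x in eq
  ... | true = refl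
  ... | false = ⊥-elim (subst T eq (ℕ.<⇒<ᵇ u<x))
  keep-<ᵇ-insert {x = x} u<x (y ∷ p) q with y <ᵇ x
  ... | true = cong suc (keep-<ᵇ-insert u<x p q)
  ... | false = keep-<ᵇ-insert u<x p q

  -- The minimum forms an inversion with each entry before it and with none after it, so deleting it
  -- changes the count exactly as moving it to the front changes the sign.
  inversions-min : ∀ p u q → All (u <_) p → All (u <_) q →
    inversions (p ++ u ∷ q) ≡ length p + inversions (p ++ q)
  inversions-min [] u q _ u<q rewrite keep-<ᵇ-none u<q = refl
  inversions-min (x ∷ p) u q (u<x ∷ u<p) u<q
    rewrite inversions-min p u q u<p u<q | keep-<ᵇ-insert u<x p q =
      cong suc (ℕ-solve (length (keep (_<ᵇ x) (p ++ q))) (length p) (inversions (p ++ q)))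
    where
    ℕ-solve : ∀ i j k → i + (j + k) ≡ j + (i + k)
    ℕ-solve = solve-∀

  Decreasing-tail : ∀ {a as} → Decreasing (a ∷ as) → Decreasing as
  Decreasing-tail {as = []} _ = tt
  Decreasing-tail {as = _ ∷ _} (_ , d) = d

  Decreasing-∷ : ∀ {a as} → at as 0 ≤ a → Decreasing as → Decreasing (a ∷ as)
  Decreasing-∷ {as = []} _ _ = tt
  Decreasing-∷ {as = _ ∷ _} le d = le , d

  Decreasing-head : ∀ {a as} → Decreasing (a ∷ as) → at as 0 ≤ a
  Decreasing-head {as = []} _ = z≤n
  Decreasing-head {as = _ ∷ _} (le , _) = le

  at-suc≤ : ∀ {as} → Decreasing as → ∀ i → at as (suc i) ≤ at as i
  at-suc≤ {[]} _ i = z≤n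
  at-suc≤ {a ∷ as} d zero = Decreasing-head d
  at-suc≤ {a ∷ as} d (suc i) = at-suc≤ (Decreasing-tail d) i

  -- Border strips and beta numbers

  at-ext : ∀ as as′ → length as′ ≡ length as → (∀ i → at as′ i ≡ at as i) → as′ ≡ as
  at-ext [] [] _ _ = refl
  at-ext (a ∷ as) (a′ ∷ as′) len eq =
    ≡.cong₂ _∷_ (eq 0) (at-ext as as′ (ℕ.suc-injective len) (eq ∘ suc))

  -- The strip starts in the first row: inside it β(μ)_i = β(λ)_{i+1}.
  strip-from-head : ∀ a as a′ as′ → length as′ ≡ length as → a′ < a →
    (∀ i → at as′ i ≤ at as i) →
    (∀ i → at as i ≤ suc (at (a′ ∷ as′) i)) →
    (∀ j k → j ≤ k → at as′ k < at as k → at as′ j < at as j) →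
    (∀ i → at (a′ ∷ as′) i < at (a ∷ as) i → at as′ i < at as i → at (a′ ∷ as′) i < at as i) →
    ∃ λ b → beta (a′ ∷ as′) ↭ b ∷ beta as × b + sum (a ∷ as) ≡ (a + length as) + sum (a′ ∷ as′)
  strip-from-head a [] a′ [] len a′<a le square interval edge =
    a′ + 0 , ↭-refl , ℕ.+-comm (a′ + 0) (a + 0)
  strip-from-head a (a₁ ∷ as) a′ (a₁′ ∷ as′) len a′<a le square interval edge with a₁′ ℕ.<? a₁
  -- The strip ends in this row: a later nonempty row would, by connectedness, make the next row
  -- nonempty as well.
  ... | no a₁′≮a₁ with refl ← at-ext (a₁ ∷ as) (a₁′ ∷ as′) len
            (λ i → ℕ.≤∧≮⇒≡ (le i) (λ lt → a₁′≮a₁ (interval 0 i z≤n lt)))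
    = a′ + suc (length as) , ↭-refl , rearrange a a′ (suc (length as)) (a₁ + sum as)
    where
    rearrange : ∀ a a′ l s → (a′ + l) + (a + s) ≡ (a + l) + (a′ + s)
    rearrange = solve-∀
  ... | yes a₁′<a₁
    with b , perm , sums ← strip-from-head a₁ as a₁′ as′ (ℕ.suc-injective len) a₁′<a₁
           (le ∘ suc) (square ∘ suc) (λ j k j≤k → interval (suc j) (suc k) (s≤s j≤k)) (edge ∘ suc)
    -- The absence of a 2×2 square gives `a₁ ≤ suc a′`, the shared edge gives `a′ < a₁`. With
    -- `a₁ = suc a′` the new first beta number is the old second one.
    with refl ← ℕ.≤-antisym (square 0) (edge 0 a′<a a₁′<a₁)
    = b , ↭-trans (prep _ perm) (↭-trans (↭-reflexive (cong (_∷ b ∷ beta as) head≡)) (swap _ _ ↭-refl))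
    , trans (move b a (a₁ + sum as)) (trans (cong (a +_) sums) (final a a′ (length as) (a₁′ + sum as′)))
    where
    head≡ : a′ + length (a₁′ ∷ as′) ≡ suc a′ + length as
    head≡ = trans (cong (a′ +_) len) (ℕ.+-suc a′ (length as))
    move : ∀ b a s → b + (a + s) ≡ a + (b + s)
    move = solve-∀
    final : ∀ a a′ l s → a + ((suc a′ + l) + s) ≡ (a + suc l) + (a′ + s)
    final = solve-∀

  -- Rows above the strip contribute the same beta numbers to both sides. At its first row,
  -- `strip-from-head` leaves a single changed number `b`, and comparing the two sizes identifies
  -- the removed number as `b + t`. Permutations are needed because `b` sits where the strip ends.
  strip-beta : ∀ {t} lam mu → 1 ≤ t → RemovesStrip t lam mu →
    ∃ λ b → ∃ λ bs → beta mu ↭ b ∷ bs × beta lam ↭ b + t ∷ bs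
  strip-beta [] [] 1≤t (_ , _ , _ , sums , _) = ⊥-elim (ℕ.<⇒≢ 1≤t sums)
  strip-beta {t} (a ∷ as) (a′ ∷ as′) 1≤t (len , dec , le , sums , square , interval , edge) with a′ ℕ.<? a
  ... | yes a′<a with b , perm , sums′ ← strip-from-head a as a′ as′ (ℕ.suc-injective len) a′<a (le ∘ suc) square
          (λ j k j≤k lt → interval 0 (suc j) (suc k) z≤n (s≤s j≤k) a′<a lt) edge
    = b , beta as , perm , ↭-reflexive (cong (_∷ beta as) (ℕ.+-cancelʳ-≡ (sum (a′ ∷ as′)) _ _
        (trans (sym sums′) (trans (cong (b +_) sums) (rearrange b (sum (a′ ∷ as′)) t)))))
    where
    rearrange : ∀ b s t → b + (s + t) ≡ (b + t) + s
    rearrange = solve-∀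
  ... | no a′≮a with refl ← ℕ.≤∧≮⇒≡ (le 0) a′≮a
    with b , bs , perm′ , perm ← strip-beta as as′ 1≤t
           ( ℕ.suc-injective len , Decreasing-tail dec , le ∘ suc
           , ℕ.+-cancelˡ-≡ a _ _ (trans sums (ℕ.+-assoc a (sum as′) t)) , square ∘ suc
           , (λ i j k i≤j j≤k → interval (suc i) (suc j) (suc k) (s≤s i≤j) (s≤s j≤k)) , edge ∘ suc)
    = b , a + length as ∷ bs
    , ↭-trans (↭-reflexive (cong (λ l → a + l ∷ beta as′) (ℕ.suc-injective len))) (↭-trans (prep _ perm′) (swap _ _ ↭-refl))
    , ↭-trans (prep _ perm) (swap _ _ ↭-refl)

  -- The converse construction: `shape` is the partition whose beta numbers are those of `a ∷ as`
  -- with the largest one, `a + length as`, replaced by `b`. The fields are the clauses of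
  -- `RemovesStrip` for a strip that starts in the first row, with its size expressed by `sums`
  -- without subtraction.
  record HeadStrip (b : ℕ) (a : ℕ) (as : List ℕ) : Set where
    field
      shape      : List ℕ
      length≡    : length shape ≡ suc (length as)
      decreasing : Decreasing shape
      sums       : b + sum (a ∷ as) ≡ (a + length as) + sum shape
      below      : ∀ i → at shape i ≤ at (a ∷ as) i
      square     : ∀ i → at as i ≤ suc (at shape i)
      head<      : at shape 0 < a
      interval   : ∀ j k → j ≤ k → at shape k < at (a ∷ as) k → at shape j < at (a ∷ as) j
      edge       : ∀ i → at shape i < at (a ∷ as) i → at shape (suc i) < at as i → at shape i < at as i

  -- The number `b` is inserted into the decreasing list `beta as`; the strip reaches down to the
  -- row in which `b` finds its place.
  headStrip : ∀ b a as → Decreasing (a ∷ as) → b < a + length as → b ∉ beta as → HeadStrip b a as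
  headStrip b a [] d b< b∉ = record
    { shape = b ∷ []
    ; length≡ = refl
    ; decreasing = tt
    ; sums = rearrange b a
    ; below = λ { zero → ℕ.<⇒≤ b<a ; (suc i) → z≤n }
    ; square = λ _ → z≤n
    ; head< = b<a
    ; interval = λ { zero zero _ lt → lt ; zero (suc k) _ () ; (suc j) (suc k) _ () }
    ; edge = λ { _ _ () }
    }
    where
    b<a : b < a
    b<a = subst (b <_) (ℕ.+-identityʳ a) b<
    rearrange : ∀ b a → b + (a + 0) ≡ (a + 0) + (b + 0)
    rearrange = solve-∀
  headStrip b a (a₁ ∷ as) d@(a₁≤a , d′) b< b∉ with ℕ.<-cmp b (a₁ + length as)
  ... | tri≈ _ b≡ _ = ⊥-elim (b∉ (here b≡))
  -- Here `b` remains the largest beta number, so the strip lies within the first row.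
  ... | tri> _ _ b> = record
    { shape = e ∷ a₁ ∷ as
    ; length≡ = refl
    ; decreasing = a₁≤e , d′
    ; sums = trans (cong (_+ (a + (a₁ + sum as))) b≡) (rearrange e a (suc (length as)) (a₁ + sum as))
    ; below = λ { zero → ℕ.<⇒≤ e<a ; (suc i) → ℕ.≤-refl }
    ; square = λ { zero → ℕ.m≤n⇒m≤1+n a₁≤e ; (suc i) → ℕ.m≤n⇒m≤1+n (at-suc≤ d′ i) }
    ; head< = e<a
    ; interval = λ { zero zero _ lt → lt ; zero (suc k) _ lt → ⊥-elim (ℕ.<-irrefl refl lt)
                   ; (suc j) (suc k) _ lt → ⊥-elim (ℕ.<-irrefl refl lt) }
    ; edge = λ { zero _ lt → ⊥-elim (ℕ.<-irrefl refl lt) ; (suc i) lt _ → ⊥-elim (ℕ.<-irrefl refl lt) }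
    }
    where
    L = suc (length as)
    e = b ∸ L
    b≥ : a₁ + L ≤ b
    b≥ = subst (_≤ b) (sym (ℕ.+-suc a₁ (length as))) b>
    b≡ : b ≡ e + L
    b≡ = sym (ℕ.m∸n+n≡m (ℕ.≤-trans (ℕ.m≤n+m L a₁) b≥))
    a₁≤e : a₁ ≤ e
    a₁≤e = ℕ.+-cancelʳ-≤ L a₁ e (subst (a₁ + L ≤_) b≡ b≥)
    e<a : e < a
    e<a = ℕ.+-cancelʳ-< L e a (subst (_< a + L) b≡ b<)
    rearrange : ∀ e a l s → (e + l) + (a + s) ≡ (a + l) + (e + s)
    rearrange = solve-∀
  ... | tri< b<′ _ _ with headStrip b a₁ as d′ b<′ (b∉ ∘ there)
  -- The first row inherits the beta number of the second one. It therefore shrinks to one box less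
  -- than the second row, the overlap that is just enough for connectedness and too small for a 2×2
  -- square.
  headStrip b a (suc e ∷ as) (e<a , d′) b< b∉ | tri< b<′ _ _ | S = record
    { shape = e ∷ shape
    ; length≡ = cong suc length≡
    ; decreasing = Decreasing-∷ (ℕ.≤-pred head<) decreasing
    ; sums = trans (move b a (suc e + sum as)) (trans (cong (a +_) sums) (final a e (length as) (sum shape)))
    ; below = λ { zero → ℕ.<⇒≤ e<a ; (suc i) → below i }
    ; square = λ { zero → ℕ.≤-refl ; (suc i) → square i }
    ; head< = e<a
    ; interval = λ { zero k _ lt → e<a ; (suc j) (suc k) (s≤s j≤k) lt → interval j k j≤k lt }
    ; edge = λ { zero _ _ → ℕ.≤-refl ; (suc i) → edge i }
    }
    where
    open HeadStrip S
    move : ∀ b a s → b + (a + s) ≡ a + (b + s)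
    move = solve-∀
    final : ∀ a e l s → a + ((suc e + l) + s) ≡ (a + suc l) + (e + s)
    final = solve-∀
  headStrip b a (zero ∷ as) _ _ _ | tri< _ _ _ | S = ⊥-elim (ℕ.n≮0 (HeadStrip.head< S))

  -- Rows above the one whose beta number is `b + t` are kept; from that row on, `headStrip`
  -- replaces `b + t` by `b`.
  strip-exists : ∀ {t} b lam → 1 ≤ t → Decreasing lam → b + t ∈ beta lam → b ∉ beta lam → ∃ (RemovesStrip t lam)
  strip-exists {t} b (a ∷ as) 1≤t d (here b+t≡) b∉ =
    shape , length≡ , decreasing , below
    , ℕ.+-cancelˡ-≡ b _ _ (trans sums (trans (cong (_+ sum shape) (sym b+t≡)) (rearrange b t (sum shape))))
    , square , (λ i j k _ j≤k _ → interval j k j≤k) , edge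
    where
    open HeadStrip (headStrip b a as d (subst (b <_) b+t≡ (ℕ.m<m+n b 1≤t)) (b∉ ∘ there))
    rearrange : ∀ b t s → (b + t) + s ≡ b + (s + t)
    rearrange = solve-∀
  strip-exists {t} b (a ∷ as) 1≤t d (there b+t∈) b∉
    with mu , len , dec , le , sums , square , interval , edge ← strip-exists b as 1≤t (Decreasing-tail d) b+t∈ (b∉ ∘ there)
    = a ∷ mu , cong suc len , Decreasing-∷ (ℕ.≤-trans (le 0) (Decreasing-head d)) dec
    , (λ { zero → ℕ.≤-refl ; (suc i) → le i })
    , trans (cong (a +_) sums) (sym (ℕ.+-assoc a (sum mu) t))
    , (λ { zero → ℕ.m≤n⇒m≤1+n (Decreasing-head d) ; (suc i) → square i })
    , (λ { zero _ _ _ _ lt → ⊥-elim (ℕ.<-irrefl refl lt)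
         ; (suc i) (suc j) (suc k) (s≤s i≤j) (s≤s j≤k) → interval i j k i≤j j≤k })
    , (λ { zero lt → ⊥-elim (ℕ.<-irrefl refl lt) ; (suc i) → edge i })

  core-flush : ∀ {t κ} → 1 ≤ t → Decreasing κ → (∀ mu → ¬ RemovesStrip t κ mu) → ∀ b → b + t ∈ beta κ → b ∈ beta κ
  core-flush {κ = κ} 1≤t d core b b+t∈ with b ∈? beta κ
  ... | yes b∈ = b∈
  ... | no b∉ with mu , strip ← strip-exists b κ 1≤t d b+t∈ b∉ = ⊥-elim (core mu strip)

  beta-strict : ∀ lam → Decreasing lam → AllPairs ℕ._>_ (beta lam)
  beta-strict [] _ = []
  beta-strict (a ∷ as) d = below a as d ∷ beta-strict as (Decreasing-tail d)
    where
    below : ∀ a as → Decreasing (a ∷ as) → All (_< a + length as) (beta as)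
    below a [] _ = []
    below a (a₁ ∷ as) (a₁≤a , d) = ℕ.+-mono-≤-< a₁≤a ℕ.≤-refl ∷
      All.map (λ lt → ℕ.<-≤-trans lt (ℕ.+-mono-≤ a₁≤a (ℕ.n≤1+n _))) (below a₁ as d)

  length-beta : ∀ lam → length (beta lam) ≡ length lam
  length-beta lam = trans (List.length-zipWith _+_ lam (downFrom (length lam)))
    (trans (cong (length lam ℕ.⊓_) (List.length-downFrom (length lam))) (ℕ.⊓-idem _))

  beta-replicate : ∀ m → beta (replicate m 0) ≡ downFrom m
  beta-replicate zero = refl
  beta-replicate (suc m) = ≡.cong₂ _∷_ (List.length-replicate m) (beta-replicate m)

  partLength-zero : ∀ l → Decreasing l → at l 0 ≤ 0 → partLength l ≡ 0
  partLength-zero [] _ _ = refl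
  partLength-zero (zero ∷ l) d _ = partLength-zero l (Decreasing-tail d) (Decreasing-head d)

  downFrom-+ : ∀ m k → downFrom (m + k) ≡ map (k +_) (downFrom m) ++ downFrom k
  downFrom-+ zero k = refl
  downFrom-+ (suc m) k = ≡.cong₂ _∷_ (ℕ.+-comm m k) (downFrom-+ m k)

  keep-all : ∀ {a} {A : Set a} {p : A → Bool} {l} → All (λ c → p c ≡ true) l → keep p l ≡ l
  keep-all [] = refl
  keep-all (pc ∷ pl) rewrite pc = cong (_ ∷_) (keep-all pl)

  upTo-++ : ∀ m k → upTo (m + k) ≡ upTo m ++ map (m +_) (upTo k)
  upTo-++ zero k = sym (List.map-id (upTo k))
  upTo-++ (suc m) k = cong (0 ∷_) (begin
    applyUpTo suc (m + k)                 ≡⟨ List.map-upTo suc (m + k) ⟨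
    map suc (upTo (m + k))                          ≡⟨ cong (map suc) (upTo-++ m k) ⟩
    map suc (upTo m ++ map (m +_) (upTo k))         ≡⟨ List.map-++ suc (upTo m) _ ⟩
    map suc (upTo m) ++ map suc (map (m +_) (upTo k)) ≡⟨ ≡.cong₂ _++_ (List.map-upTo suc m) (sym (List.map-∘ (upTo k))) ⟩
    applyUpTo suc m ++ map (suc m +_) (upTo k) ∎)
    where open ≡.≡-Reasoning

  upTo-split : ∀ c d → upTo (c + suc d) ≡ upTo c ++ c ∷ map (suc c +_) (upTo d)
  upTo-split c d = trans (upTo-++ c (suc d)) (cong (upTo c ++_) (≡.cong₂ _∷_ (ℕ.+-identityʳ c)
    (trans (List.map-applyUpTo suc (c +_) d) (trans (sym (List.map-upTo (λ j → c + suc j) d))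
      (List.map-cong (ℕ.+-suc c) (upTo d))))))

  keep-others : ∀ c d → keep (λ i → not (i ≡ᵇ c)) (upTo (c + suc d)) ≡ upTo c ++ map (suc c +_) (upTo d)
  keep-others c d rewrite upTo-split c d | keep-++ (λ i → not (i ≡ᵇ c)) (upTo c) (c ∷ map (suc c +_) (upTo d))
    | ≡ᵇ-true {c} {c} refl = ≡.cong₂ _++_
      (keep-all (All.map (λ i<c → cong not (≡ᵇ-false (ℕ.<⇒≢ i<c))) (All.applyUpTo⁺₁ id c id)))
      (keep-all (All.map⁺ (All.tabulate λ {j} _ → cong not (≡ᵇ-false (ℕ.<⇒≢ (ℕ.m≤m+n (suc c) j) ∘ sym)))))

  module _ {A : Set} (f : A → ℕ) where

    private
      fibre : List A → ℕ → List A
      fibre l i = keep (λ x → f x ≡ᵇ i) l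

      fibres-absent : ∀ x l L → All (f x ≢_) L → concatMap (fibre (x ∷ l)) L ≡ concatMap (fibre l) L
      fibres-absent x l [] _ = refl
      fibres-absent x l (i ∷ L) (fx≢i ∷ fx≢L) rewrite ≡ᵇ-false fx≢i = cong (fibre l i ++_) (fibres-absent x l L fx≢L)

      fibres-∷ : ∀ x l {L} → Unique L → f x ∈ L → concatMap (fibre (x ∷ l)) L ↭ x ∷ concatMap (fibre l) L
      fibres-∷ x l (≢L ∷ uL) (here refl) rewrite ≡ᵇ-true {f x} refl = prep x (Perm.++⁺ˡ (fibre l (f x)) (↭-reflexive (fibres-absent x l _ ≢L)))
      fibres-∷ x l {i ∷ L} (≢L ∷ uL) (there fx∈) rewrite ≡ᵇ-false (All.lookup ≢L fx∈ ∘ sym) =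
        ↭-trans (Perm.++⁺ˡ (fibre l i) (fibres-∷ x l uL fx∈)) (Perm.shift x (fibre l i) _)

    concatMap-fibres : ∀ l {L} → Unique L → All (λ x → f x ∈ L) l →
      concatMap (λ i → keep (λ x → f x ≡ᵇ i) l) L ↭ l
    concatMap-fibres [] {L} _ _ = ↭-reflexive (concatMap-[] L)
    concatMap-fibres (x ∷ l) uL (fx∈ ∷ fl∈) = ↭-trans (fibres-∷ x l uL fx∈) (prep x (concatMap-fibres l uL fl∈))

  map-at : ∀ l → map (at l) (upTo (length l)) ≡ l
  map-at l = trans (List.map-upTo (at l) (length l)) (tabulated l)
    where
    tabulated : ∀ l → applyUpTo (at l) (length l) ≡ l
    tabulated [] = refl
    tabulated (x ∷ l) = cong (x ∷_) (tabulated l)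

  -- Residue classes of beta numbers, cores and the order of columns given by σ

  module Residues (t : ℕ) .{{nz : NonZero t}} where

    class : ℕ → List ℕ → List ℕ
    class i l = keep (λ b → (b % t) ≡ᵇ i) l

    nRes-strip : ∀ i lam mu → 1 ≤ t → RemovesStrip t lam mu → nRes t i lam ≡ nRes t i mu
    nRes-strip i lam mu 1≤t strip with b , bs , perm′ , perm ← strip-beta lam mu 1≤t strip =
      trans (Perm.↭-length (keep-↭ (λ b → (b % t) ≡ᵇ i) perm))
        (trans same (sym (Perm.↭-length (keep-↭ (λ b → (b % t) ≡ᵇ i) perm′))))
      where
      same : length (class i (b + t ∷ bs)) ≡ length (class i (b ∷ bs))
      same rewrite ℕ.[m+n]%n≡m%n b t {{nz}} with (b % t) ≡ᵇ i
      ... | true = refl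
      ... | false = refl

    nRes-reach : ∀ i {lam κ} → 1 ≤ t → Reach t lam κ → nRes t i lam ≡ nRes t i κ
    nRes-reach i 1≤t done = refl
    nRes-reach i {lam} 1≤t (step {mu = mu} strip reach) = trans (nRes-strip i lam mu 1≤t strip) (nRes-reach i 1≤t reach)

    reach-decreasing : ∀ {lam κ} → Decreasing lam → Reach t lam κ → Decreasing κ
    reach-decreasing d done = d
    reach-decreasing d (step (_ , d′ , _) reach) = reach-decreasing d′ reach

    -- Removals keep trailing zeros, so the beta sets of a partition and of its core are formed with
    -- the same m and can be compared.
    reach-length : ∀ {lam κ} → Reach t lam κ → length κ ≡ length lam
    reach-length done = refl
    reach-length (step (len , _) reach) = trans (reach-length reach) len

    -- By flushness every number r, r + t, r + 2t, ... up to `e` on the runner of `e` is a beta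
    -- number, and at least k + 1 of them exist when `e / t` is at least k.
    core-nRes : ∀ {κ e} k → 1 ≤ t → Decreasing κ → (∀ mu → ¬ RemovesStrip t κ mu) → e ∈ beta κ →
      k ≤ e / t → suc k ≤ nRes t (e % t) κ
    core-nRes {κ} {e} k 1≤t d core e∈ k≤ = ℕ.≤-trans (ℕ.≤-reflexive (sym len)) (unique-⊆⇒length≤ unique sub)
      where
      r = e % t
      f : ℕ → ℕ
      f j = r + j * t
      runner = map f (upTo (suc k))
      len : length runner ≡ suc k
      len = trans (List.length-map f (upTo (suc k))) (List.length-upTo (suc k))
      unique : Unique runner
      unique = Unique.map⁺ (λ {i} {j} eq → ℕ.*-cancelʳ-≡ i j t (ℕ.+-cancelˡ-≡ r _ _ eq)) (Unique.upTo⁺ (suc k))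
      descend : ∀ m j → j + m ≡ e / t → f j ∈ beta κ
      descend zero j eq = subst (_∈ beta κ) (trans (ℕ.m≡m%n+[m/n]*n e t)
        (cong f (trans (sym eq) (ℕ.+-identityʳ j)))) e∈
      descend (suc m) j eq = core-flush 1≤t d core (f j)
        (subst (_∈ beta κ) (rearrange r j t) (descend m (suc j) (trans (sym (ℕ.+-suc j m)) eq)))
        where
        rearrange : ∀ r j t → r + (t + j * t) ≡ (r + j * t) + t
        rearrange = solve-∀
      sub : ∀ {x} → x ∈ runner → x ∈ betaRes t r κ
      sub x∈ with j , j∈ , refl ← ∈-map⁻ f {xs = upTo (suc k)} x∈ =
        ∈-keep⁺ _ (descend (e / t ∸ j) j (ℕ.m+[n∸m]≡n (ℕ.≤-trans (ℕ.≤-pred (∈-upTo⁻ j∈)) k≤)))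
          (≡ᵇ-true (trans (ℕ.[m+kn]%n≡m%n r j t) (ℕ.m%n%n≡m%n e t)))

    -- With tn + 1 parts, the second beta number is κ₂ + tn - 1; it reaches tn as soon as κ₂ is
    -- nonzero.
    long-core : ∀ n κ → 1 ≤ t → length κ ≡ t * n + 1 → Decreasing κ → 1 < partLength κ →
      ∃ λ e₁ → ∃ λ e₂ → e₁ ∈ beta κ × e₂ ∈ beta κ × t * n ≤ e₂ × e₂ < e₁
    long-core n (zero ∷ κ) 1≤t len d 1<p = ⊥-elim (ℕ.n≮0 (ℕ.≤-trans 1<p (ℕ.≤-reflexive (partLength-zero κ (Decreasing-tail d) (Decreasing-head d)))))
    long-core n (suc a ∷ []) 1≤t len d (s≤s ())
    long-core n (suc a ∷ zero ∷ κ) 1≤t len d (s≤s 1≤p) = ⊥-elim (ℕ.n≮0 (ℕ.≤-trans 1≤p (ℕ.≤-reflexive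
        (partLength-zero κ (Decreasing-tail (Decreasing-tail {suc a} d)) (Decreasing-head (Decreasing-tail {suc a} d))))))
    long-core n (suc a ∷ suc b ∷ κ) 1≤t len (b≤a , d) 1<p =
      suc a + suc (length κ) , suc b + length κ , here refl , there (here refl)
      , ℕ.≤-trans (ℕ.≤-reflexive (ℕ.suc-injective (trans (ℕ.+-comm 1 (t * n)) (sym len)))) (s≤s (ℕ.m≤n+m (length κ) b))
      , ℕ.+-mono-≤-< b≤a ℕ.≤-refl

    block-% : ∀ n {m} → m < t → (t * n + m) % t ≡ m
    block-% n {m} m<t = trans (cong (_% t) (trans (ℕ.+-comm (t * n) m) (cong (m +_) (ℕ.*-comm t n))))
      (trans (ℕ.[m+kn]%n≡m%n m n t) (ℕ.m<n⇒m%n≡m m<t))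

    block-class-[] : ∀ n m i → m ≤ i → i < t → class i (map (t * n +_) (downFrom m)) ≡ []
    block-class-[] n zero i m≤i i<t = refl
    block-class-[] n (suc m) i m<i i<t
      rewrite block-% n (ℕ.<-trans m<i i<t) | ≡ᵇ-false (ℕ.<⇒≢ m<i) = block-class-[] n m i (ℕ.<⇒≤ m<i) i<t

    block-class : ∀ n m i → i < m → m ≤ t → class i (map (t * n +_) (downFrom m)) ≡ t * n + i ∷ []
    block-class n (suc m) i i<m m<t with m ℕ.≟ i
    ... | yes refl rewrite block-% n m<t | ≡ᵇ-true {m} refl = cong (t * n + m ∷_) (block-class-[] n m m ℕ.≤-refl m<t)
    ... | no m≢i rewrite block-% n m<t | ≡ᵇ-false m≢i =
      block-class n m i (ℕ.≤∧≢⇒< (ℕ.≤-pred i<m) (m≢i ∘ sym)) (ℕ.<⇒≤ m<t)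

    class-downFrom : ∀ n i → i < t → class i (downFrom (t * suc n)) ≡ t * n + i ∷ class i (downFrom (t * n))
    class-downFrom n i i<t
      rewrite ℕ.*-suc t n | downFrom-+ t (t * n) | keep-++ (λ b → (b % t) ≡ᵇ i) (map (t * n +_) (downFrom t)) (downFrom (t * n))
      = cong (_++ class i (downFrom (t * n))) (block-class n t i i<t ℕ.≤-refl)

    length-class-downFrom : ∀ n i → i < t → length (class i (downFrom (t * n))) ≡ n
    length-class-downFrom zero i i<t rewrite ℕ.*-zeroʳ t = refl
    length-class-downFrom (suc n) i i<t = trans (cong length (class-downFrom n i i<t)) (cong suc (length-class-downFrom n i i<t))

    beta-row : ∀ c n → beta (c ∷ replicate (t * n) 0) ≡ c + t * n ∷ downFrom (t * n)
    beta-row c n = ≡.cong₂ _∷_ (cong (c +_) (List.length-replicate (t * n))) (beta-replicate (t * n))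

    length-class-row-≡ : ∀ c n → c < t → length (class c (c + t * n ∷ downFrom (t * n))) ≡ suc n
    length-class-row-≡ c n c<t
      rewrite ℕ.+-comm c (t * n) | block-% n c<t | ≡ᵇ-true {c} refl = cong suc (length-class-downFrom n c c<t)

    class-row-≢ : ∀ c n i → c < t → c ≢ i → class i (c + t * n ∷ downFrom (t * n)) ≡ class i (downFrom (t * n))
    class-row-≢ c n i c<t c≢i
      rewrite ℕ.+-comm c (t * n) | block-% n c<t | ≡ᵇ-false c≢i = refl

    others : ℕ → List ℕ
    others c = keep (λ i → not (i ≡ᵇ c)) (upTo t)

    after : ℕ → List ℕ
    after c = map (suc c +_) (upTo (t ∸ suc c))

    c+1+d≡t : ∀ {c} → c < t → c + suc (t ∸ suc c) ≡ t
    c+1+d≡t {c} c<t = trans (ℕ.+-suc c (t ∸ suc c)) (ℕ.m+[n∸m]≡n c<t)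

    others≡ : ∀ {c} → c < t → others c ≡ upTo c ++ after c
    others≡ {c} c<t = subst (λ k → keep (λ i → not (i ≡ᵇ c)) (upTo k) ≡ upTo c ++ after c) (c+1+d≡t c<t) (keep-others c (t ∸ suc c))

    upTo≡ : ∀ {c} → c < t → upTo t ≡ upTo c ++ c ∷ after c
    upTo≡ {c} c<t = subst (λ k → upTo k ≡ upTo c ++ c ∷ after c) (c+1+d≡t c<t) (upTo-split c (t ∸ suc c))

    length-others : ∀ {c} → c < t → length (others c) ≡ t ∸ 1
    length-others {c} c<t = trans (cong length (others≡ c<t)) (trans (List.length-++ (upTo c))
      (trans (≡.cong₂ _+_ (List.length-upTo c) (trans (List.length-map _ (upTo (t ∸ suc c))) (List.length-upTo (t ∸ suc c))))
        (cong (_∸ 1) (trans (sym (ℕ.+-suc c (t ∸ suc c))) (c+1+d≡t c<t)))))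

    others-∈ : ∀ c → All (λ i → i < t × c ≢ i) (others c)
    others-∈ c = All.zip (All-keep⁺ _ (All.applyUpTo⁺₁ id t id) ,
      All.map (λ {i} eq c≡i → contradiction (trans (sym eq) (cong not (≡ᵇ-true (sym c≡i)))) (λ ())) (keep-satisfies _ (upTo t)))

    arrange : ℕ → List ℕ → List ℕ
    arrange c B = class c B ++ concatMap (λ i → class i B) (others c)

    map-posRes : ∀ i lam → map (at (beta lam)) (posRes t i lam) ≡ betaRes t i lam
    map-posRes i lam = trans (sym (keep-map (λ b → (b % t) ≡ᵇ i) (at (beta lam)) (upTo (length lam))))
      (cong (class i) (trans (cong (map (at (beta lam)) ∘ upTo) (sym (length-beta lam))) (map-at (beta lam))))

    map-sigmaList : ∀ c lam → map (at (beta lam)) (sigmaList t c lam) ≡ arrange c (beta lam)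
    map-sigmaList c lam = trans (List.map-++ _ (posRes t c lam) _) (≡.cong₂ _++_ (map-posRes c lam)
      (trans (List.map-concatMap _ (λ i → posRes t i lam) (others c)) (List.concatMap-cong (λ i → map-posRes i lam) (others c))))

    -- Once the class of `c` is moved back between the smaller and the larger residues, the list is
    -- the concatenation of all fibres of the residue map.
    sigmaList-↭ : ∀ {c} lam → c < t → sigmaList t c lam ↭ upTo (length lam)
    sigmaList-↭ {c} lam c<t = ↭-trans
      (↭-reflexive (cong (C c ++_) (trans (cong (concatMap C) (others≡ c<t)) (List.concatMap-++ C (upTo c) (after c)))))
      (↭-trans (Perm.shifts (C c) (concatMap C (upTo c)))
      (↭-trans (↭-reflexive (trans (sym (List.concatMap-++ C (upTo c) (c ∷ after c))) (cong (concatMap C) (sym (upTo≡ c<t)))))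
      (concatMap-fibres (λ j → at (beta lam) j % t) (upTo (length lam)) (Unique.upTo⁺ t)
        (All.tabulate (λ {j} _ → ∈-upTo⁺ (ℕ.m%n<n (at (beta lam) j) t))))))
      where
      C = λ i → posRes t i lam

    quotients-strict : ∀ i {l} → All (λ b → (b % t ≡ᵇ i) ≡ true) l → AllPairs ℕ._>_ l → AllPairs ℕ._>_ (map (_/ t) l)
    quotients-strict i [] [] = []
    quotients-strict i {b ∷ l} (b≡ ∷ l≡) (b>l ∷ l>) =
      All.map⁺ (All.zipWith (λ { {b′} (b′≡ , b>b′) → ℕ.*-cancelʳ-< t (b′ / t) (b / t) (ℕ.+-cancelˡ-< i _ _
        (≡.subst₂ _<_ (split b′ b′≡) (split b b≡) b>b′)) }) (l≡ , b>l)) ∷ quotients-strict i l≡ l>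
      where
      split : ∀ b → (b % t ≡ᵇ i) ≡ true → b ≡ i + b / t * t
      split b b≡ = trans (ℕ.m≡m%n+[m/n]*n b t) (cong (_+ b / t * t) (≡ᵇ-true⁻ b≡))

  -- Column exponents of alternants and of quotients

  take-length-++ : ∀ {a} {A : Set a} (xs ys : List A) → take (length xs) (xs ++ ys) ≡ xs
  take-length-++ [] ys = refl
  take-length-++ (x ∷ xs) ys = cong (x ∷_) (take-length-++ xs ys)

  length≤head : ∀ {b l} → AllPairs ℕ._>_ (b ∷ l) → length l ≤ b
  length≤head {l = []} _ = z≤n
  length≤head {l = _ ∷ _} ((b>c ∷ _) ∷ l>) = ℕ.≤-trans (s≤s (length≤head l>)) b>c

  -- Strictness makes the truncated subtraction in the definition of the quotient harmless.
  unshift : ∀ {q} o N {f : ℕ → ℕ} → (∀ j → f j ≡ o + j) → o + length q ≡ N → AllPairs ℕ._>_ q →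
    zipWith _+_ (zipWith (λ b j → (b + suc j) ∸ N) q (applyUpTo f (length q))) (downFrom (length q)) ≡ q
  unshift o N f≡ N≡ [] = refl
  unshift {b ∷ q} o N {f} f≡ N≡ q>@(_ ∷ q>′) = ≡.cong₂ _∷_
    (trans (cong (_+ length q) first) (ℕ.m∸n+n≡m (length≤head q>)))
    (unshift (suc o) N (λ j → trans (f≡ (suc j)) (ℕ.+-suc o j)) (trans (sym (ℕ.+-suc o (length q))) N≡) q>′)
    where
    first : b + suc (f 0) ∸ N ≡ b ∸ length q
    first = trans (≡.cong₂ (λ u v → b + suc u ∸ v) (trans (f≡ 0) (ℕ.+-identityʳ o)) (sym N≡))
      (trans (≡.cong₂ _∸_ (ℕ.+-comm b (suc o)) (ℕ.+-suc o (length q))) (ℕ.[m+n]∸[m+o]≡n∸o (suc o) b (length q)))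

  exponents : ℕ → List ℕ → List ℕ
  exponents N μ = zipWith _+_ (pad N μ) (downFrom N)

  exponents-exact : ∀ μ → exponents (length μ) μ ≡ beta μ
  exponents-exact μ = cong (λ ν → zipWith _+_ ν (downFrom (length μ))) (take-length-++ μ (replicate (length μ) 0))

  exponents-[] : ∀ N → exponents N [] ≡ downFrom N
  exponents-[] N = trans (cong (λ ν → zipWith _+_ ν (downFrom N)) take≡) (zeros N)
    where
    take≡ : pad N [] ≡ replicate N 0
    take≡ = List.take-all N (replicate N 0) (ℕ.≤-reflexive (List.length-replicate N))
    zeros : ∀ N → zipWith _+_ (replicate N 0) (downFrom N) ≡ downFrom N
    zeros zero = refl
    zeros (suc N) = cong (N ∷_) (zeros N)

  -- The definition of λ^(i) read backwards: its beta numbers, formed with n_i parts, are the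
  -- numbers β̃^(i). Hence the diagonal blocks become alternants of the quotients.
  exponents-quotient : ∀ t .{{_ : NonZero t}} i lam → Decreasing lam →
    exponents (nRes t i lam) (quotient t i lam) ≡ map (_/ t) (betaRes t i lam)
  exponents-quotient t i lam d = begin
    exponents N (quotient t i lam)          ≡⟨ cong (λ k → exponents k (quotient t i lam)) (sym len) ⟩
    exponents (length (quotient t i lam)) (quotient t i lam) ≡⟨ exponents-exact (quotient t i lam) ⟩
    beta (quotient t i lam)                 ≡⟨ cong (λ k → zipWith _+_ (quotient t i lam) (downFrom k)) len ⟩
    zipWith _+_ (quotient t i lam) (downFrom N) ≡⟨ cong (λ k → zipWith _+_ (zipWith (λ b j → (b + suc j) ∸ N) q (upTo k)) (downFrom k)) (sym lenq) ⟩
    zipWith _+_ (zipWith (λ b j → (b + suc j) ∸ N) q (upTo (length q))) (downFrom (length q))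
      ≡⟨ unshift 0 N (λ _ → refl) lenq (quotients-strict i (keep-satisfies _ (beta lam)) (AllPairs-keep⁺ _ (beta-strict lam d))) ⟩
    q ∎
    where
    open ≡.≡-Reasoning
    open Residues t
    N = nRes t i lam
    q = map (_/ t) (betaRes t i lam)
    lenq : length q ≡ N
    lenq = List.length-map (_/ t) (betaRes t i lam)
    len : length (quotient t i lam) ≡ N
    len = trans (List.length-zipWith _ q (upTo N)) (trans (≡.cong₂ ℕ._⊓_ lenq (List.length-upTo N)) (ℕ.⊓-idem N))

  length-pad : ∀ N μ → length (pad N μ) ≡ N
  length-pad N μ = trans (List.length-take N (μ ++ replicate N 0))
    (ℕ.m≤n⇒m⊓n≡m (ℕ.≤-trans (ℕ.m≤n+m N (length μ))
      (ℕ.≤-reflexive (sym (trans (List.length-++ μ) (cong (length μ +_) (List.length-replicate N)))))))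

open Combinatorics

module Determinant {a ℓ} (F : Field a ℓ) where
  open FieldOps F
  open import Relation.Binary.Reasoning.Setoid setoid
  open import Algebra.Properties.Ring ring using (-1*x≈-x; -‿involutive)
  open import Algebra.Solver.Ring.NaturalCoefficients.Default commutativeSemiring
    using (solve; _:=_; _:+_; _:*_)

  private variable
    b e : Level
    A : Set b
    E : Set e

  -- Powers, signs and products in a field

  -1# : Carrier
  -1# = - 1#

  x-x≈0 : ∀ x → x ⊕ -1# · x ≈ 0#
  x-x≈0 x = trans (+-congˡ (-1*x≈-x x)) (-‿inverseʳ x)

  -1²≈1 : -1# · -1# ≈ 1#
  -1²≈1 = trans (-1*x≈-x -1#) (-‿involutive 1#)

  -1·-1· : ∀ x → -1# · (-1# · x) ≈ x
  -1·-1· x = trans (sym (*-assoc _ _ _)) (trans (*-congʳ -1²≈1) (*-identityˡ x))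

  ^-+ : ∀ x m n → x ^ (m + n) ≈ x ^ m · x ^ n
  ^-+ x zero n = sym (*-identityˡ _)
  ^-+ x (suc m) n = trans (*-congˡ (^-+ x m n)) (sym (*-assoc _ _ _))

  ^-cong : ∀ {x y} n → x ≈ y → x ^ n ≈ y ^ n
  ^-cong zero p = refl
  ^-cong (suc n) p = *-cong p (^-cong n p)

  1^ : ∀ n → 1# ^ n ≈ 1#
  1^ zero = refl
  1^ (suc n) = trans (*-identityˡ _) (1^ n)

  ^-* : ∀ x m n → x ^ (m * n) ≈ (x ^ n) ^ m
  ^-* x zero n = refl
  ^-* x (suc m) n = trans (^-+ x n (m * n)) (*-congˡ (^-* x m n))

  ·-^ : ∀ x y n → (x · y) ^ n ≈ x ^ n · y ^ n
  ·-^ x y zero = sym (*-identityˡ _)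
  ·-^ x y (suc n) = trans (*-congˡ (·-^ x y n))
    (solve 4 (λ x y u v → (x :* y) :* (u :* v) := (x :* u) :* (y :* v)) refl x y _ _)

  sgnPow-double : ∀ k → sgnPow k · sgnPow k ≈ 1#
  sgnPow-double k = begin
    sgnPow k · sgnPow k ≈⟨ ·-^ -1# -1# k ⟨
    (-1# · -1#) ^ k     ≈⟨ ^-cong k -1²≈1 ⟩
    1# ^ k              ≈⟨ 1^ k ⟩
    1#                  ∎

  sgnPow-square : ∀ n → sgnPow (n * n) ≈ sgnPow n
  sgnPow-square zero = refl
  sgnPow-square (suc n) = *-congˡ (begin
    sgnPow (n + n * suc n)              ≡⟨ cong (λ k → sgnPow (n + k)) (ℕ.*-suc n n) ⟩
    sgnPow (n + (n + n * n))            ≈⟨ trans (^-+ -1# n _) (*-congˡ (^-+ -1# n _)) ⟩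
    sgnPow n · (sgnPow n · sgnPow (n * n)) ≈⟨ *-assoc _ _ _ ⟨
    (sgnPow n · sgnPow n) · sgnPow (n * n) ≈⟨ *-congʳ (sgnPow-double n) ⟩
    1# · sgnPow (n * n)                 ≈⟨ *-identityˡ _ ⟩
    sgnPow (n * n)                      ≈⟨ sgnPow-square n ⟩
    sgnPow n                            ∎)

  -- Moving n rows past cn rows costs cn·n transpositions, while the theorem is stated with cn; n²
  -- and n have the same parity.
  sgnPow-*-square : ∀ c n → sgnPow (c * n * n) ≈ sgnPow (c * n)
  sgnPow-*-square c n = begin
    sgnPow (c * n * n)    ≡⟨ cong sgnPow (ℕ.*-assoc c n n) ⟩
    sgnPow (c * (n * n))  ≈⟨ ^-* -1# c (n * n) ⟩
    sgnPow (n * n) ^ c    ≈⟨ ^-cong c (sgnPow-square n) ⟩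
    sgnPow n ^ c          ≈⟨ ^-* -1# c n ⟨
    sgnPow (c * n)        ∎

  prod-· : ∀ {b} {A : Set b} (f g : A → Carrier) L → prod (map (λ i → f i · g i) L) ≈ prod (map f L) · prod (map g L)
  prod-· f g [] = sym (*-identityˡ _)
  prod-· f g (i ∷ L) = trans (*-congˡ (prod-· f g L))
    (solve 4 (λ u v p q → (u :* v) :* (p :* q) := (u :* p) :* (v :* q)) refl _ _ _ _)

  prod-cong : ∀ {b} {A : Set b} {f g : A → Carrier} {L} → All (λ i → f i ≈ g i) L → prod (map f L) ≈ prod (map g L)
  prod-cong [] = refl
  prod-cong (eq ∷ eqs) = *-cong eq (prod-cong eqs)

  prod-insert : ∀ {b} {A : Set b} (f : A → Carrier) p c q → f c · prod (map f (p ++ q)) ≈ prod (map f (p ++ c ∷ q))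
  prod-insert f [] c q = refl
  prod-insert f (i ∷ p) c q = trans (solve 3 (λ u v w → u :* (v :* w) := v :* (u :* w)) refl _ _ _) (*-congˡ (prod-insert f p c q))

  prod-ratio : ∀ {b} {A : Set b} (f : A → Carrier) {v} → v ≉ 0# → ∀ L →
    prod (map (λ i → f i · v ⁻¹) L) · v ^ length L ≈ prod (map f L)
  prod-ratio f v≉0 [] = *-identityˡ _
  prod-ratio f {v} v≉0 (i ∷ L) = begin
    ((f i · v ⁻¹) · prod (map (λ i → f i · v ⁻¹) L)) · (v · v ^ length L)
      ≈⟨ solve 5 (λ f w p v u → ((f :* w) :* p) :* (v :* u) := (f :* (v :* w)) :* (p :* u)) refl _ _ _ _ _ ⟩
    (f i · (v · v ⁻¹)) · (prod (map (λ i → f i · v ⁻¹) L) · v ^ length L)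
      ≈⟨ *-cong (trans (*-congˡ (⁻¹-inverse v v≉0)) (*-identityʳ _)) (prod-ratio f v≉0 L) ⟩
    f i · prod (map f L) ∎

  prod-const : ∀ {b} {A : Set b} {f : A → Carrier} {v L} → All (λ i → f i ≈ v) L → prod (map f L) ≈ v ^ length L
  prod-const [] = refl
  prod-const (eq ∷ eqs) = *-cong eq (prod-const eqs)

  -- Alternating functionals

  Functional : ∀ {b} → Set b → Set _
  Functional A = List A → Carrier

  Swaps : Functional A → Set _
  Swaps g = ∀ p u v q → g (p ++ u ∷ v ∷ q) ≈ -1# · g (p ++ v ∷ u ∷ q)

  -- Kept apart from `Swaps`, which in characteristic 2 does not imply it.
  Repeats : Functional A → Set _
  Repeats g = ∀ p u q → g (p ++ u ∷ u ∷ q) ≈ 0#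

  move-one : {g : Functional A} → Swaps g → ∀ u ys zs →
    g (u ∷ ys ++ zs) ≈ sgnPow (length ys) · g (ys ++ u ∷ zs)
  move-one sw u [] zs = sym (*-identityˡ _)
  move-one {g = g} sw u (y ∷ ys) zs = begin
    g (u ∷ y ∷ ys ++ zs)                            ≈⟨ sw [] u y (ys ++ zs) ⟩
    -1# · g (y ∷ u ∷ ys ++ zs)                      ≈⟨ *-congˡ (move-one {g = g ∘ (y ∷_)} (sw ∘ (y ∷_)) u ys zs) ⟩
    -1# · (sgnPow (length ys) · g (y ∷ ys ++ u ∷ zs)) ≈⟨ *-assoc _ _ _ ⟨
    sgnPow (suc (length ys)) · g (y ∷ ys ++ u ∷ zs) ∎

  move-block : {g : Functional A} → Swaps g → ∀ xs ys zs →
    g (xs ++ ys ++ zs) ≈ sgnPow (length xs * length ys) · g (ys ++ xs ++ zs)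
  move-block sw [] ys zs = sym (*-identityˡ _)
  move-block {g = g} sw (x ∷ xs) ys zs = begin
    g (x ∷ xs ++ ys ++ zs)
      ≈⟨ move-block {g = g ∘ (x ∷_)} (sw ∘ (x ∷_)) xs ys zs ⟩
    sgnPow (length xs * length ys) · g (x ∷ ys ++ xs ++ zs)
      ≈⟨ *-congˡ (move-one {g = g} sw x ys (xs ++ zs)) ⟩
    sgnPow (length xs * length ys) · (sgnPow (length ys) · g (ys ++ x ∷ xs ++ zs))
      ≈⟨ solve 3 (λ u v w → u :* (v :* w) := (v :* u) :* w) refl _ _ _ ⟩
    (sgnPow (length ys) · sgnPow (length xs * length ys)) · g (ys ++ x ∷ xs ++ zs)
      ≈⟨ *-congʳ (^-+ -1# (length ys) _) ⟨
    sgnPow (length ys + length xs * length ys) · g (ys ++ x ∷ xs ++ zs) ∎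

  swaps-prefix : ∀ {b} {A : Set b} {g : Functional A} → Swaps g → ∀ p → Swaps (λ l → g (p ++ l))
  swaps-prefix {g = g} sw p q u v r = trans (reflexive (cong g (≡.sym (List.++-assoc p q (u ∷ v ∷ r)))))
    (trans (sw (p ++ q) u v r) (*-congˡ (reflexive (cong g (List.++-assoc p q (v ∷ u ∷ r))))))

  -- The entry `X j` has to pass the j completed blocks `X i ∷ C i` with i < j, each of m + 1
  -- entries; the costs j(m + 1) add up to C(k,2)(m + 1).
  interleave : ∀ {b} {A : Set b} {g : Functional A} → Swaps g → (X : ℕ → A) (C : ℕ → List A) (m k : ℕ) →
    (∀ i → i < k → length (C i) ≡ m) → ∀ q →
    g (map X (downFrom k) ++ concatMap C (upTo k) ++ q)
      ≈ sgnPow (triangle k * suc m) · g (concatMap (λ i → X i ∷ C i) (upTo k) ++ q)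
  interleave sw X C m zero len q = sym (*-identityˡ _)
  interleave {g = g} sw X C m (suc k) len q = begin
    g (X k ∷ map X (downFrom k) ++ concatMap C (upTo (suc k)) ++ q)
      ≡⟨ cong (λ l → g (X k ∷ map X (downFrom k) ++ l)) (snoc C) ⟩
    g (X k ∷ map X (downFrom k) ++ concatMap C (upTo k) ++ C k ++ q)
      ≈⟨ interleave {g = g ∘ (X k ∷_)} (sw ∘ (X k ∷_)) X C m k (λ i → len i ∘ ℕ.m<n⇒m<1+n) (C k ++ q) ⟩
    sgnPow (triangle k * suc m) · g (X k ∷ concatMap C′ (upTo k) ++ C k ++ q)
      ≈⟨ *-congˡ (move-one {g = g} sw (X k) (concatMap C′ (upTo k)) (C k ++ q)) ⟩
    sgnPow (triangle k * suc m) · (sgnPow (length (concatMap C′ (upTo k))) · g (concatMap C′ (upTo k) ++ C′ k ++ q))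
      ≈⟨ solve 3 (λ u v w → u :* (v :* w) := (v :* u) :* w) refl _ _ _ ⟩
    (sgnPow (length (concatMap C′ (upTo k))) · sgnPow (triangle k * suc m)) · g (concatMap C′ (upTo k) ++ C′ k ++ q)
      ≈⟨ *-cong (sym (^-+ -1# (length (concatMap C′ (upTo k))) _)) (reflexive (cong g (≡.sym (snoc C′)))) ⟩
    sgnPow (length (concatMap C′ (upTo k)) + triangle k * suc m) · g (concatMap C′ (upTo (suc k)) ++ q)
      ≡⟨ cong (λ j → sgnPow j · g (concatMap C′ (upTo (suc k)) ++ q))
           (≡.trans (cong (_+ triangle k * suc m) len′) (≡.sym (ℕ.*-distribʳ-+ (suc m) k (triangle k)))) ⟩
    sgnPow (triangle (suc k) * suc m) · g (concatMap C′ (upTo (suc k)) ++ q) ∎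
    where
    C′ = λ i → X i ∷ C i
    snoc : ∀ (f : ℕ → List _) → concatMap f (upTo (suc k)) ++ q ≡ concatMap f (upTo k) ++ f k ++ q
    snoc f = ≡.trans (cong (λ l → concatMap f l ++ q) (≡.sym (List.upTo-∷ʳ k)))
      (≡.trans (cong (_++ q) (≡.trans (List.concatMap-++ f (upTo k) (k ∷ [])) (cong (concatMap f (upTo k) ++_) (List.++-identityʳ (f k)))))
        (List.++-assoc (concatMap f (upTo k)) (f k) q))
    len′ : length (concatMap C′ (upTo k)) ≡ k * suc m
    len′ = ≡.trans (length-concatMap (All.applyUpTo⁺₁ id k (λ {i} i<k → cong suc (len i (ℕ.m<n⇒m<1+n i<k)))))
      (cong (_* suc m) (List.length-upTo k))

  repeated⇒0 : {g : Functional A} → Swaps g → Repeats g → ∀ {u l} → u ∈ l → g (u ∷ l) ≈ 0#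
  repeated⇒0 {g = g} sw rp {u} u∈l with ps , qs , ≡.refl ← ∈-∃++ u∈l = begin
    g (u ∷ ps ++ u ∷ qs)                        ≈⟨ move-one {g = g} sw u ps (u ∷ qs) ⟩
    sgnPow (length ps) · g (ps ++ u ∷ u ∷ qs)   ≈⟨ *-congˡ (rp ps u qs) ⟩
    sgnPow (length ps) · 0#                     ≈⟨ zeroʳ _ ⟩
    0#                                          ∎

  -- Bring the minimum to the front, then sort the rest.
  sort-sign : ∀ {g : Functional ℕ} → Swaps g → ∀ {s σ} → AllPairs _<_ s → σ ↭ s →
    g σ ≈ sgn σ · g s
  sort-sign sw [] σ↭s with ≡.refl ← Perm.↭-empty-inv σ↭s = sym (*-identityˡ _)
  sort-sign {g} sw {u ∷ s} (u<s ∷ s↗) σ↭s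
    with p , q , ≡.refl ← ∈-∃++ (Perm.∈-resp-↭ (↭-sym σ↭s) (here ≡.refl)) = begin
      g (p ++ u ∷ q)
        ≈⟨ trans (*-congˡ (move-one {g = g} sw u p q)) (trans (sym (*-assoc _ _ _)) (trans (*-congʳ (sgnPow-double (length p))) (*-identityˡ _))) ⟨
      sgnPow (length p) · g (u ∷ p ++ q)
        ≈⟨ *-congˡ (sort-sign {g ∘ (u ∷_)} (sw ∘ (u ∷_)) s↗ rest) ⟩
      sgnPow (length p) · (sgn (p ++ q) · g (u ∷ s))
        ≈⟨ *-assoc _ _ _ ⟨
      (sgnPow (length p) · sgn (p ++ q)) · g (u ∷ s)
        ≈⟨ *-congʳ (^-+ -1# (length p) _) ⟨
      sgnPow (length p + inversions (p ++ q)) · g (u ∷ s)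
        ≡⟨ cong (λ k → sgnPow k · g (u ∷ s)) (inversions-min p u q (All.++⁻ˡ p u<) (All.++⁻ʳ p u<)) ⟨
      sgn (p ++ u ∷ q) · g (u ∷ s) ∎
    where
    rest : p ++ q ↭ s
    rest = Perm.drop-mid p [] σ↭s
    u< : All (u <_) (p ++ q)
    u< = Perm.All-resp-↭ (↭-sym rest) u<s

  -- A matrix is a list of rows r : E → Carrier together with a list of columns
  -- in E.  Laplace expansion along r is the contraction of an alternating form
  -- with r, so a determinant is an iterated contraction.

  lap : (E → Carrier) → Functional E → Functional E
  lap r g [] = 0#
  lap r g (c ∷ cs) = r c · g cs ⊕ -1# · lap r (g ∘ (c ∷_)) cs

  -- The determinant without rows. Its value 0 on leftover columns makes `D` vanish on column lists
  -- of the wrong length and starts all the vanishing arguments.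
  ε : Functional E
  ε [] = 1#
  ε (_ ∷ _) = 0#

  laps : List (E → Carrier) → Functional E → Functional E
  laps rs g = foldr lap g rs

  D : List (E → Carrier) → Functional E
  D rs = laps rs ε

  -- Meant for the column change `h = _/ t`, with `u` the power of the variable that is split off;
  -- `P` restricts the comparison to one residue class, where such a splitting is uniform.
  lap-transport : ∀ {p} {E₁ E₂ : Set e} {P : E₁ → Set p} {h : E₁ → E₂} {r r′ g g′} u k →
    (∀ c → P c → r c ≈ u · r′ (h c)) →
    (∀ l → All P l → g l ≈ k · g′ (map h l)) →
    ∀ {cs} → All P cs → lap r g cs ≈ (u · k) · lap r′ g′ (map h cs)
  lap-transport u k r≈ g≈ [] = sym (zeroʳ _)
  lap-transport {h = h} {r} {r′} {g} {g′} u k r≈ g≈ {c ∷ cs} (pc ∷ pcs) = begin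
    r c · g cs ⊕ -1# · lap r (g ∘ (c ∷_)) cs
      ≈⟨ +-cong (*-cong (r≈ c pc) (g≈ cs pcs)) (*-congˡ (lap-transport u k r≈ (λ l pl → g≈ (c ∷ l) (pc ∷ pl)) pcs)) ⟩
    (u · r′ (h c)) · (k · g′ (map h cs)) ⊕ -1# · ((u · k) · lap r′ (g′ ∘ (h c ∷_)) (map h cs))
      ≈⟨ solve 6 (λ u v k w m l → (u :* v) :* (k :* w) :+ m :* ((u :* k) :* l) := (u :* k) :* (v :* w :+ m :* l)) refl u _ k _ -1# _ ⟩
    (u · k) · (r′ (h c) · g′ (map h cs) ⊕ -1# · lap r′ (g′ ∘ (h c ∷_)) (map h cs)) ∎

  lap-cong : ∀ {r r′ : E → Carrier} {g g′} → (∀ c → r c ≈ r′ c) → (∀ l → g l ≈ g′ l) →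
    ∀ cs → lap r g cs ≈ lap r′ g′ cs
  lap-cong r≈ g≈ [] = refl
  lap-cong r≈ g≈ (c ∷ cs) = +-cong (*-cong (r≈ c) (g≈ cs)) (*-congˡ (lap-cong r≈ (g≈ ∘ (c ∷_)) cs))

  lap-zero : ∀ {r : E → Carrier} {g} → (∀ l → g l ≈ 0#) → ∀ cs → lap r g cs ≈ 0#
  lap-zero g≈ [] = refl
  lap-zero g≈ (c ∷ cs) = trans (+-cong (trans (*-congˡ (g≈ cs)) (zeroʳ _))
    (trans (*-congˡ (lap-zero (g≈ ∘ (c ∷_)) cs)) (zeroʳ _))) (+-identityˡ _)

  lap-linear : ∀ {r : E → Carrier} {g g′} u v cs →
    lap r (λ l → u · g l ⊕ v · g′ l) cs ≈ u · lap r g cs ⊕ v · lap r g′ cs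
  lap-linear u v [] = sym (trans (+-cong (zeroʳ u) (zeroʳ v)) (+-identityˡ _))
  lap-linear {r = r} {g} {g′} u v (c ∷ cs) = begin
    r c · (u · g cs ⊕ v · g′ cs) ⊕ -1# · lap r (λ l → u · g (c ∷ l) ⊕ v · g′ (c ∷ l)) cs
      ≈⟨ +-congˡ (*-congˡ (lap-linear u v cs)) ⟩
    r c · (u · g cs ⊕ v · g′ cs) ⊕ -1# · (u · lap r (g ∘ (c ∷_)) cs ⊕ v · lap r (g′ ∘ (c ∷_)) cs)
      ≈⟨ solve 8 (λ u v r m g g′ l l′ → r :* (u :* g :+ v :* g′) :+ m :* (u :* l :+ v :* l′)
           := u :* (r :* g :+ m :* l) :+ v :* (r :* g′ :+ m :* l′)) refl u v (r c) -1# _ _ _ _ ⟩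
    u · lap r g (c ∷ cs) ⊕ v · lap r g′ (c ∷ cs) ∎

  lap-∷ : ∀ (r s : E → Carrier) g c cs →
    lap r (lap s g) (c ∷ cs) ≈
      r c · lap s g cs ⊕ -1# · (s c · lap r g cs ⊕ -1# · lap r (lap s (g ∘ (c ∷_))) cs)
  lap-∷ r s g c cs = +-congˡ (*-congˡ (lap-linear (s c) -1# cs))

  -- In the expansion along the first column `c`, the terms in which `r` or `s` takes `c` are
  -- exchanged with opposite signs; the term in which neither takes it is covered by induction.
  lap-anticomm : ∀ (r s : E → Carrier) g cs → lap r (lap s g) cs ≈ -1# · lap s (lap r g) cs
  lap-anticomm r s g [] = sym (zeroʳ _)
  lap-anticomm r s g (c ∷ cs) = begin
    lap r (lap s g) (c ∷ cs)                  ≈⟨ lap-∷ r s g c cs ⟩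
    rc · S ⊕ -1# · (sc · R ⊕ -1# · lap r (lap s (g ∘ (c ∷_))) cs)
      ≈⟨ +-congˡ (*-congˡ (+-congˡ (*-congˡ (lap-anticomm r s (g ∘ (c ∷_)) cs)))) ⟩
    rc · S ⊕ -1# · (sc · R ⊕ -1# · (-1# · SR)) ≈⟨ +-congʳ (-1·-1· _) ⟨
    -1# · (-1# · (rc · S)) ⊕ -1# · (sc · R ⊕ -1# · (-1# · SR))
      ≈⟨ solve 4 (λ m x y z → m :* (m :* x) :+ m :* (y :+ m :* (m :* z)) := m :* (y :+ m :* (x :+ m :* z))) refl -1# _ _ _ ⟩
    -1# · (sc · R ⊕ -1# · (rc · S ⊕ -1# · SR)) ≈⟨ *-congˡ (lap-∷ s r g c cs) ⟨
    -1# · lap s (lap r g) (c ∷ cs)            ∎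
    where
    rc = r c
    sc = s c
    S = lap s g cs
    R = lap r g cs
    SR = lap s (lap r (g ∘ (c ∷_))) cs

  -- Anticommutation only shows that twice the value is 0, which says nothing in characteristic 2.
  -- The induction is therefore repeated: the two terms with `r c` cancel.
  lap-square : ∀ (r : E → Carrier) g cs → lap r (lap r g) cs ≈ 0#
  lap-square r g [] = refl
  lap-square r g (c ∷ cs) = begin
    lap r (lap r g) (c ∷ cs) ≈⟨ lap-∷ r r g c cs ⟩
    r c · lap r g cs ⊕ -1# · (r c · lap r g cs ⊕ -1# · lap r (lap r (g ∘ (c ∷_))) cs)
      ≈⟨ +-congˡ (*-congˡ (+-congˡ (trans (*-congˡ (lap-square r _ cs)) (zeroʳ _)))) ⟩
    r c · lap r g cs ⊕ -1# · (r c · lap r g cs ⊕ 0#) ≈⟨ +-congˡ (*-congˡ (+-identityʳ _)) ⟩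
    r c · lap r g cs ⊕ -1# · (r c · lap r g cs) ≈⟨ x-x≈0 _ ⟩
    0# ∎

  lap-scale : ∀ {r : E → Carrier} {g} u cs → lap r (λ l → u · g l) cs ≈ u · lap r g cs
  lap-scale u [] = sym (zeroʳ u)
  lap-scale {r = r} {g} u (c ∷ cs) = trans (+-congˡ (*-congˡ (lap-scale u cs)))
    (solve 5 (λ u r g m l → r :* (u :* g) :+ m :* (u :* l) := u :* (r :* g :+ m :* l)) refl u _ _ -1# _)

  rows-swap : ∀ (g : Functional E) cs → Swaps (λ rs → laps rs g cs)
  rows-swap g cs [] u v q = lap-anticomm u v (laps q g) cs
  rows-swap g cs (r ∷ p) u v q = trans (lap-cong (λ _ → refl) (λ l → rows-swap g l p u v q) cs) (lap-scale -1# cs)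

  rows-repeat : ∀ (g : Functional E) cs → Repeats (λ rs → laps rs g cs)
  rows-repeat g cs [] u q = lap-square u (laps q g) cs
  rows-repeat g cs (r ∷ p) u q = lap-zero (λ l → rows-repeat g l p u q) cs

  lap-swaps : ∀ {r : E → Carrier} {g} → Swaps g → Swaps (lap r g)
  lap-swaps {r = r} {g} sw [] u v q = begin
    r u · g (v ∷ q) ⊕ -1# · (r v · g (u ∷ q) ⊕ -1# · lap r (λ l → g (u ∷ v ∷ l)) q)
      ≈⟨ +-congˡ (*-congˡ (+-congˡ (*-congˡ (trans (lap-cong (λ _ → refl) (sw [] u v) q) (lap-scale -1# q))))) ⟩
    r u · g (v ∷ q) ⊕ -1# · (r v · g (u ∷ q) ⊕ -1# · (-1# · lap r (λ l → g (v ∷ u ∷ l)) q))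
      ≈⟨ +-congʳ (-1·-1· _) ⟨
    -1# · (-1# · (r u · g (v ∷ q))) ⊕ -1# · (r v · g (u ∷ q) ⊕ -1# · (-1# · lap r (λ l → g (v ∷ u ∷ l)) q))
      ≈⟨ solve 4 (λ m x y z → m :* (m :* x) :+ m :* (y :+ m :* (m :* z)) := m :* (y :+ m :* (x :+ m :* z))) refl -1# _ _ _ ⟩
    -1# · (r v · g (u ∷ q) ⊕ -1# · (r u · g (v ∷ q) ⊕ -1# · lap r (λ l → g (v ∷ u ∷ l)) q)) ∎
  lap-swaps {r = r} {g} sw (c ∷ p) u v q = begin
    r c · g (p ++ u ∷ v ∷ q) ⊕ -1# · lap r (g ∘ (c ∷_)) (p ++ u ∷ v ∷ q)
      ≈⟨ +-cong (*-congˡ (sw p u v q)) (*-congˡ (lap-swaps (sw ∘ (c ∷_)) p u v q)) ⟩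
    r c · (-1# · g (p ++ v ∷ u ∷ q)) ⊕ -1# · (-1# · lap r (g ∘ (c ∷_)) (p ++ v ∷ u ∷ q))
      ≈⟨ solve 4 (λ m r g l → r :* (m :* g) :+ m :* (m :* l) := m :* (r :* g :+ m :* l)) refl -1# _ _ _ ⟩
    -1# · (r c · g (p ++ v ∷ u ∷ q) ⊕ -1# · lap r (g ∘ (c ∷_)) (p ++ v ∷ u ∷ q)) ∎

  D-swaps : ∀ (rs : List (E → Carrier)) → Swaps (D rs)
  D-swaps [] [] u v q = sym (zeroʳ _)
  D-swaps [] (_ ∷ _) u v q = sym (zeroʳ _)
  D-swaps (r ∷ rs) = lap-swaps (D-swaps rs)

  laps-transport : ∀ {p} {E₁ E₂ : Set e} {P : E₁ → Set p} {h : E₁ → E₂}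
    {f : A → E₁ → Carrier} {f′ : A → E₂ → Carrier} {g g′} (u : A → Carrier) k →
    (∀ y c → P c → f y c ≈ u y · f′ y (h c)) →
    (∀ l → All P l → g l ≈ k · g′ (map h l)) →
    ∀ L {cs} → All P cs →
    laps (map f L) g cs ≈ (prod (map u L) · k) · laps (map f′ L) g′ (map h cs)
  laps-transport u k f≈ g≈ [] {cs} pcs = trans (g≈ cs pcs) (*-congʳ (sym (*-identityˡ k)))
  laps-transport u k f≈ g≈ (y ∷ L) {cs} pcs =
    trans (lap-transport (u y) (prod (map u L) · k) (f≈ y) (λ l → laps-transport u k f≈ g≈ L) pcs)
          (*-congʳ (sym (*-assoc _ _ _)))

  laps-++ : ∀ (rs ss : List (E → Carrier)) g cs → laps (rs ++ ss) g cs ≡ laps rs (laps ss g) cs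
  laps-++ rs ss g cs = cong (λ h → h cs) (List.foldr-++ lap g rs ss)

  laps-cong : ∀ {f f′ : A → E → Carrier} → (∀ y c → f y c ≈ f′ y c) → ∀ L g cs →
    laps (map f L) g cs ≈ laps (map f′ L) g cs
  laps-cong f≈ [] g cs = refl
  laps-cong f≈ (y ∷ L) g cs = lap-cong (f≈ y) (laps-cong f≈ L g) cs

  -- Comparison with the determinant of a list of lists

  dropAt-map-++ : ∀ {e} {E : Set e} (s : E → Carrier) pre c suf →
    dropAt (length pre) (map s (pre ++ c ∷ suf)) ≡ map s (pre ++ suf)
  dropAt-map-++ s [] c suf = ≡.refl
  dropAt-map-++ s (x ∷ pre) c suf = cong (s x ∷_) (dropAt-map-++ s pre c suf)

  matrix : List (E → Carrier) → List E → List (List Carrier)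
  matrix rs cs = map (λ r → map r cs) rs

  mutual
    detN-matrix : ∀ (rs : List (E → Carrier)) cs → length cs ≡ length rs →
      detN (length rs) (matrix rs cs) ≈ D rs cs
    detN-matrix [] [] _ = refl
    detN-matrix (r ∷ rs) cs eq = trans (expand-matrix r rs [] cs eq) (*-identityˡ _)

    -- The columns already passed form `pre`. `expand` keeps their number as an index, which fixes
    -- both the sign and the column to drop, whereas `lap` prepends the columns themselves and
    -- multiplies by `-1#` at each step.
    expand-matrix : ∀ (r : E → Carrier) rs pre suf → length (pre ++ suf) ≡ suc (length rs) →
      expand (length rs) (length pre) (map r suf) (matrix rs (pre ++ suf))
        ≈ sgnPow (length pre) · lap r (λ l → D rs (pre ++ l)) suf
    expand-matrix r rs pre [] eq = sym (zeroʳ _)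
    expand-matrix r rs pre (c ∷ suf) eq = begin
      (sgnPow j · r c) · detN (length rs) (map (dropAt j) (matrix rs (pre ++ c ∷ suf)))
        ⊕ expand (length rs) (suc j) (map r suf) (matrix rs (pre ++ c ∷ suf))
        ≡⟨ ≡.cong₂ _⊕_ (cong (λ M → (sgnPow j · r c) · detN (length rs) M) minor)
             (≡.cong₂ (λ k p → expand (length rs) k (map r suf) (matrix rs p)) (≡.sym len) (≡.sym assoc)) ⟩
      (sgnPow j · r c) · detN (length rs) (matrix rs (pre ++ suf))
        ⊕ expand (length rs) (length (pre ++ c ∷ [])) (map r suf) (matrix rs ((pre ++ c ∷ []) ++ suf))
        ≈⟨ +-cong (*-congˡ (detN-matrix rs (pre ++ suf) len′))
             (expand-matrix r rs (pre ++ c ∷ []) suf (≡.trans (cong length assoc) eq)) ⟩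
      (sgnPow j · r c) · D rs (pre ++ suf)
        ⊕ sgnPow (length (pre ++ c ∷ [])) · lap r (λ l → D rs ((pre ++ c ∷ []) ++ l)) suf
        ≈⟨ +-congˡ (*-cong (reflexive (cong sgnPow len))
             (lap-cong (λ _ → refl) (λ l → reflexive (cong (D rs) (List.++-assoc pre (c ∷ []) l))) suf)) ⟩
      (sgnPow j · r c) · D rs (pre ++ suf) ⊕ (-1# · sgnPow j) · lap r (λ l → D rs (pre ++ c ∷ l)) suf
        ≈⟨ solve 5 (λ s r d m l → (s :* r) :* d :+ (m :* s) :* l := s :* (r :* d :+ m :* l)) refl _ _ _ -1# _ ⟩
      sgnPow j · (r c · D rs (pre ++ suf) ⊕ -1# · lap r (λ l → D rs (pre ++ c ∷ l)) suf) ∎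
      where
      j = length pre
      minor : map (dropAt j) (matrix rs (pre ++ c ∷ suf)) ≡ matrix rs (pre ++ suf)
      minor = ≡.trans (≡.sym (List.map-∘ rs)) (List.map-cong (λ s → dropAt-map-++ s pre c suf) rs)
      assoc : (pre ++ c ∷ []) ++ suf ≡ pre ++ c ∷ suf
      assoc = List.++-assoc pre (c ∷ []) suf
      len : length (pre ++ c ∷ []) ≡ suc j
      len = ≡.trans (List.length-++ pre) (ℕ.+-comm j 1)
      len′ : length (pre ++ suf) ≡ length rs
      len′ = ℕ.suc-injective (≡.trans (≡.sym (≡.trans (List.length-++ pre)
        (≡.trans (ℕ.+-suc j (length suf)) (cong suc (≡.sym (List.length-++ pre)))))) eq)

  pow : Carrier → ℕ → Carrier
  pow y e = y ^ e

  alternant-D : ∀ ys μ → alternant ys μ ≈ D (map pow ys) (exponents (length ys) μ)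
  alternant-D ys μ = trans
    (reflexive (≡.cong₂ detN (≡.trans (List.length-map _ ys) (≡.sym (List.length-map pow ys))) (List.map-∘ ys)))
    (detN-matrix (map pow ys) (exponents (length ys) μ) (≡.trans len (≡.sym (List.length-map pow ys))))
    where
    len : length (exponents (length ys) μ) ≡ length ys
    len = ≡.trans (List.length-zipWith _+_ (pad (length ys) μ) (downFrom (length ys)))
      (≡.trans (≡.cong₂ ℕ._⊓_ (length-pad (length ys) μ) (List.length-downFrom (length ys))) (ℕ.⊓-idem _))

  -- Multiplicativity

  sumOver : List A → (A → Carrier) → Carrier
  sumOver [] f = 0#
  sumOver (i ∷ J) f = f i ⊕ sumOver J f

  sumOver-cong : ∀ {f f′ : A → Carrier} J → (∀ i → i ∈ J → f i ≈ f′ i) → sumOver J f ≈ sumOver J f′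
  sumOver-cong [] f≈ = refl
  sumOver-cong (i ∷ J) f≈ = +-cong (f≈ i (here ≡.refl)) (sumOver-cong J (λ i → f≈ i ∘ there))

  sumOver-++ : ∀ {f : A → Carrier} I J → sumOver (I ++ J) f ≈ sumOver I f ⊕ sumOver J f
  sumOver-++ [] J = sym (+-identityˡ _)
  sumOver-++ (i ∷ I) J = trans (+-congˡ (sumOver-++ I J)) (sym (+-assoc _ _ _))

  sumOver-zero : ∀ {f : A → Carrier} J → (∀ i → i ∈ J → f i ≈ 0#) → sumOver J f ≈ 0#
  sumOver-zero [] f≈ = refl
  sumOver-zero (i ∷ J) f≈ = trans (+-cong (f≈ i (here ≡.refl)) (sumOver-zero J (λ i → f≈ i ∘ there))) (+-identityˡ _)

  sumOver-single : ∀ {f : A → Carrier} {J k} → Unique J → k ∈ J → (∀ i → i ≢ k → f i ≈ 0#) → sumOver J f ≈ f k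
  sumOver-single {J = J} (i∉J ∷ _) (here ≡.refl) f≈ =
    trans (+-congˡ (sumOver-zero _ (λ j j∈J → f≈ j (All.lookup i∉J j∈J ∘ ≡.sym)))) (+-identityʳ _)
  sumOver-single (i∉J ∷ uJ) (there k∈J) f≈ =
    trans (+-cong (f≈ _ (All.lookup i∉J k∈J)) (sumOver-single uJ k∈J f≈)) (+-identityˡ _)

  -- A row of a matrix product: `w` is a row of the left factor, the `N i` are the rows of the right
  -- one.
  combine : List A → (A → E → Carrier) → (A → Carrier) → E → Carrier
  combine J N w c = sumOver J (λ i → w i · N i c)

  -- The multilinear expansion: the sum of w₁(i₁)⋯wₖ(iₖ) Ψ(i₁,...,iₖ) over all sequences in `J`,
  -- repetitions included.
  seqSum : List (A → Carrier) → List A → Functional A → Carrier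
  seqSum [] J Ψ = Ψ []
  seqSum (w ∷ ws) J Ψ = sumOver J (λ i → w i · seqSum ws J (Ψ ∘ (i ∷_)))

  lap-sumOver : ∀ {r : E → Carrier} (w : A → Carrier) (G : A → Functional E) J cs →
    lap r (λ l → sumOver J (λ i → w i · G i l)) cs ≈ sumOver J (λ i → w i · lap r (G i) cs)
  lap-sumOver w G [] cs = lap-zero (λ _ → refl) cs
  lap-sumOver {r = r} w G (i ∷ J) cs = begin
    lap r (λ l → w i · G i l ⊕ sumOver J (λ i → w i · G i l)) cs
      ≈⟨ lap-cong (λ _ → refl) (λ l → +-congˡ (sym (*-identityˡ _))) cs ⟩
    lap r (λ l → w i · G i l ⊕ 1# · sumOver J (λ i → w i · G i l)) cs ≈⟨ lap-linear (w i) 1# cs ⟩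
    w i · lap r (G i) cs ⊕ 1# · lap r (λ l → sumOver J (λ i → w i · G i l)) cs
      ≈⟨ +-congˡ (trans (*-identityˡ _) (lap-sumOver w G J cs)) ⟩
    w i · lap r (G i) cs ⊕ sumOver J (λ i → w i · lap r (G i) cs) ∎

  lap-seqSum : ∀ {r : E → Carrier} (ws : List (A → Carrier)) J (G : List A → Functional E) cs →
    lap r (λ l → seqSum ws J (λ k → G k l)) cs ≈ seqSum ws J (λ k → lap r (G k) cs)
  lap-seqSum [] J G cs = refl
  lap-seqSum (w ∷ ws) J G cs = trans (lap-sumOver w (λ i l → seqSum ws J (λ k → G (i ∷ k) l)) J cs)
    (sumOver-cong J (λ i _ → *-congˡ (lap-seqSum ws J (G ∘ (i ∷_)) cs)))

  lap-combine : ∀ (J : List A) (N : A → E → Carrier) w g cs →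
    lap (combine J N w) g cs ≈ sumOver J (λ i → w i · lap (N i) g cs)
  lap-combine J N w g [] = sym (sumOver-zero J (λ _ _ → zeroʳ _))
  lap-combine J N w g (c ∷ cs) = trans (+-congˡ (*-congˡ (lap-combine J N w _ cs))) (distribute J)
    where
    distribute : ∀ J → sumOver J (λ i → w i · N i c) · g cs ⊕ -1# · sumOver J (λ i → w i · lap (N i) (g ∘ (c ∷_)) cs)
      ≈ sumOver J (λ i → w i · (N i c · g cs ⊕ -1# · lap (N i) (g ∘ (c ∷_)) cs))
    distribute [] = trans (+-cong (zeroˡ _) (zeroʳ _)) (+-identityˡ _)
    distribute (i ∷ J) = trans
      (solve 7 (λ w n s g m l s′ → (w :* n :+ s) :* g :+ m :* (w :* l :+ s′)
          := w :* (n :* g :+ m :* l) :+ (s :* g :+ m :* s′)) refl _ _ _ _ _ _ _)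
      (+-congˡ (distribute J))

  laps-combine : ∀ (J : List A) (N : A → E → Carrier) ws g cs →
    laps (map (combine J N) ws) g cs ≈ seqSum ws J (λ l → laps (map N l) g cs)
  laps-combine J N [] g cs = refl
  laps-combine J N (w ∷ ws) g cs = trans (lap-combine J N w _ cs)
    (sumOver-cong J (λ i _ → *-congˡ (trans
      (lap-cong (λ _ → refl) (laps-combine J N ws g) cs)
      (lap-seqSum ws J (λ k → laps (map N k) g) cs))))

  seqSum-zero : ∀ (ws : List (A → Carrier)) J {Ψ} → (∀ l → Ψ l ≈ 0#) → seqSum ws J Ψ ≈ 0#
  seqSum-zero [] J Ψ≈ = Ψ≈ []
  seqSum-zero (w ∷ ws) J Ψ≈ = sumOver-zero J (λ i _ → trans (*-congˡ (seqSum-zero ws J (Ψ≈ ∘ (i ∷_)))) (zeroʳ _))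

  -- Applied after `i` has been chosen: an alternating Ψ vanishes if `i` recurs, so the later
  -- indices range over the remaining elements only.
  seqSum-drop : ∀ (ws : List (A → Carrier)) pre {i} suf {Ψ} → (∀ {l} → i ∈ l → Ψ l ≈ 0#) →
    seqSum ws (pre ++ i ∷ suf) Ψ ≈ seqSum ws (pre ++ suf) Ψ
  seqSum-drop [] pre suf Ψ0 = refl
  seqSum-drop (w ∷ ws) pre {i} suf {Ψ} Ψ0 = begin
    sumOver (pre ++ i ∷ suf) (λ j → w j · seqSum ws (pre ++ i ∷ suf) (Ψ ∘ (j ∷_)))
      ≈⟨ sumOver-cong (pre ++ i ∷ suf) (λ j _ → *-congˡ (seqSum-drop ws pre suf (Ψ0 ∘ there))) ⟩
    sumOver (pre ++ i ∷ suf) f ≈⟨ sumOver-++ pre (i ∷ suf) ⟩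
    sumOver pre f ⊕ (f i ⊕ sumOver suf f)
      ≈⟨ +-congˡ (+-congʳ (trans (*-congˡ (seqSum-zero ws (pre ++ suf) (λ _ → Ψ0 (here ≡.refl)))) (zeroʳ _))) ⟩
    sumOver pre f ⊕ (0# ⊕ sumOver suf f) ≈⟨ +-congˡ (+-identityˡ _) ⟩
    sumOver pre f ⊕ sumOver suf f ≈⟨ sumOver-++ pre suf ⟨
    sumOver (pre ++ suf) f ∎
    where
    f = λ j → w j · seqSum ws (pre ++ suf) (Ψ ∘ (j ∷_))

  mutual
    -- For each first index `i`, the remaining sum is by induction a minor of the weights times Ψ(i,
    -- rest). Moving `i` back to its place in `J` produces the sign of the Laplace expansion, so the
    -- minors assemble to `D ws J`.
    seqSum-alternating : ∀ (ws : List (A → Carrier)) J {Ψ} → Swaps Ψ → Repeats Ψ → length J ≡ length ws →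
      seqSum ws J Ψ ≈ D ws J · Ψ J
    seqSum-alternating [] [] sw rp eq = sym (*-identityˡ _)
    seqSum-alternating (w ∷ ws) J sw rp eq =
      trans (seqSum-expand w ws [] J sw rp eq) (*-congʳ (*-identityˡ _))

    seqSum-expand : ∀ (w : A → Carrier) ws pre suf {Ψ} → Swaps Ψ → Repeats Ψ →
      length (pre ++ suf) ≡ suc (length ws) →
      sumOver suf (λ i → w i · seqSum ws (pre ++ suf) (Ψ ∘ (i ∷_)))
        ≈ (sgnPow (length pre) · lap w (λ l → D ws (pre ++ l)) suf) · Ψ (pre ++ suf)
    seqSum-expand w ws pre [] sw rp eq = sym (trans (*-congʳ (zeroʳ _)) (zeroˡ _))
    seqSum-expand w ws pre (i ∷ suf) {Ψ} sw rp eq = begin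
      w i · seqSum ws (pre ++ i ∷ suf) (Ψ ∘ (i ∷_)) ⊕ sumOver suf (λ j → w j · seqSum ws (pre ++ i ∷ suf) (Ψ ∘ (j ∷_)))
        ≈⟨ +-cong (*-congˡ (trans (seqSum-drop ws pre suf (repeated⇒0 {g = Ψ} sw rp))
             (seqSum-alternating ws (pre ++ suf) (sw ∘ (i ∷_)) (rp ∘ (i ∷_)) len′)))
             (reflexive (cong (λ K → sumOver suf (λ j → w j · seqSum ws K (Ψ ∘ (j ∷_)))) (≡.sym assoc))) ⟩
      w i · (D ws (pre ++ suf) · Ψ (i ∷ pre ++ suf)) ⊕ sumOver suf (λ j → w j · seqSum ws ((pre ++ i ∷ []) ++ suf) (Ψ ∘ (j ∷_)))
        ≈⟨ +-cong (*-congˡ (*-congˡ (move-one {g = Ψ} sw i pre suf)))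
             (seqSum-expand w ws (pre ++ i ∷ []) suf {Ψ} sw rp (≡.trans (cong length assoc) eq)) ⟩
      w i · (D ws (pre ++ suf) · (sgnPow k · Ψ (pre ++ i ∷ suf)))
        ⊕ (sgnPow (length (pre ++ i ∷ [])) · lap w (λ l → D ws ((pre ++ i ∷ []) ++ l)) suf) · Ψ ((pre ++ i ∷ []) ++ suf)
        ≈⟨ +-congˡ (*-cong (*-cong (reflexive (cong sgnPow len))
             (lap-cong (λ _ → refl) (λ l → reflexive (cong (D ws) (List.++-assoc pre (i ∷ []) l))) suf)) (reflexive (cong Ψ assoc))) ⟩
      w i · (D ws (pre ++ suf) · (sgnPow k · Ψ (pre ++ i ∷ suf)))
        ⊕ ((-1# · sgnPow k) · lap w (λ l → D ws (pre ++ i ∷ l)) suf) · Ψ (pre ++ i ∷ suf)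
        ≈⟨ solve 6 (λ w d s p m l → w :* (d :* (s :* p)) :+ ((m :* s) :* l) :* p
             := (s :* (w :* d :+ m :* l)) :* p) refl _ _ _ _ -1# _ ⟩
      (sgnPow k · (w i · D ws (pre ++ suf) ⊕ -1# · lap w (λ l → D ws (pre ++ i ∷ l)) suf)) · Ψ (pre ++ i ∷ suf) ∎
      where
      k = length pre
      assoc : (pre ++ i ∷ []) ++ suf ≡ pre ++ i ∷ suf
      assoc = List.++-assoc pre (i ∷ []) suf
      len : length (pre ++ i ∷ []) ≡ suc k
      len = ≡.trans (List.length-++ pre) (ℕ.+-comm k 1)
      len′ : length (pre ++ suf) ≡ length ws
      len′ = ℕ.suc-injective (≡.trans (≡.sym (≡.trans (List.length-++ pre)
        (≡.trans (ℕ.+-suc k (length suf)) (cong suc (≡.sym (List.length-++ pre)))))) eq)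

  -- A general `g` in place of `ε` leaves room for rows that the product does not touch; here this
  -- is the row of ones.
  laps-multiplicative : ∀ (J : List A) (N : A → E → Carrier) ws g cs → length J ≡ length ws →
    laps (map (combine J N) ws) g cs ≈ D ws J · laps (map N J) g cs
  laps-multiplicative J N ws g cs eq = trans (laps-combine J N ws g cs)
    (seqSum-alternating ws J
      (λ p u v q → trans (reflexive (cong (λ rs → laps rs g cs) (List.map-++ N p (u ∷ v ∷ q))))
        (trans (rows-swap g cs (map N p) (N u) (N v) (map N q))
          (*-congˡ (reflexive (cong (λ rs → laps rs g cs) (≡.sym (List.map-++ N p (v ∷ u ∷ q))))))))
      (λ p u q → trans (reflexive (cong (λ rs → laps rs g cs) (List.map-++ N p (u ∷ u ∷ q))))
        (rows-repeat g cs (map N p) (N u) (map N q)))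
      eq)

  -- Vanishing on lists with too many columns of a given kind

  VanishesFrom : (E → Bool) → ℕ → Functional E → Set _
  VanishesFrom Z k g = ∀ l → k ≤ count Z l → g l ≈ 0#

  private
    x≈0∧y≈0⇒x-y≈0 : ∀ {x y} → x ≈ 0# → y ≈ 0# → x ⊕ -1# · y ≈ 0#
    x≈0∧y≈0⇒x-y≈0 x≈0 y≈0 = trans (+-cong x≈0 (trans (*-congˡ y≈0) (zeroʳ _))) (+-identityˡ _)

    prepend-true : ∀ (Z : E → Bool) {g : Functional E} {k} m {c} → Z c ≡ true →
      (∀ l → k ≤ m + count Z l → g l ≈ 0#) → ∀ l → k ≤ suc m + count Z l → g (c ∷ l) ≈ 0#
    prepend-true Z m eq g0 l le = g0 (_ ∷ l) (ℕ.≤-trans le (ℕ.≤-reflexive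
      (≡.sym (≡.trans (cong (m +_) (count-true Z l eq)) (ℕ.+-suc m _)))))

    prepend-false : ∀ (Z : E → Bool) {g : Functional E} {k} m {c} → Z c ≡ false →
      (∀ l → k ≤ m + count Z l → g l ≈ 0#) → ∀ l → k ≤ m + count Z l → g (c ∷ l) ≈ 0#
    prepend-false Z m eq g0 l le = g0 (_ ∷ l) (ℕ.≤-trans le (ℕ.≤-reflexive
      (≡.sym (cong (m +_) (count-false Z l eq)))))

    -- m counts the columns of kind Z already passed by the expansion.
    lap-vanishes′ : ∀ (Z : E → Bool) {r g k} m → (∀ l → k ≤ m + count Z l → g l ≈ 0#) →
      ∀ l → suc k ≤ m + count Z l → lap r g l ≈ 0#
    lap-vanishes′ Z m g0 [] _ = refl
    lap-vanishes′ Z m g0 (c ∷ cs) le with Z c in eq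
    ... | true = x≈0∧y≈0⇒x-y≈0 (trans (*-congˡ (g0 cs (ℕ.≤-pred le′))) (zeroʳ _))
        (lap-vanishes′ Z (suc m) (prepend-true Z m eq g0) cs le′)
      where le′ = ℕ.≤-trans le (ℕ.≤-reflexive (ℕ.+-suc m _))
    ... | false = x≈0∧y≈0⇒x-y≈0 (trans (*-congˡ (g0 cs (ℕ.≤-trans (ℕ.n≤1+n _) le))) (zeroʳ _))
        (lap-vanishes′ Z m (prepend-false Z m eq g0) cs le)

    lap-vanishes-zero′ : ∀ (Z : E → Bool) {r g k} m → (∀ c → Z c ≡ true → r c ≈ 0#) →
      (∀ l → k ≤ m + count Z l → g l ≈ 0#) → ∀ l → k ≤ m + count Z l → lap r g l ≈ 0#
    lap-vanishes-zero′ Z m r0 g0 [] _ = refl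
    lap-vanishes-zero′ Z m r0 g0 (c ∷ cs) le with Z c in eq
    ... | true = x≈0∧y≈0⇒x-y≈0 (trans (*-congʳ (r0 c eq)) (zeroˡ _))
        (lap-vanishes-zero′ Z (suc m) r0 (prepend-true Z m eq g0) cs (ℕ.≤-trans le (ℕ.≤-reflexive (ℕ.+-suc m _))))
    ... | false = x≈0∧y≈0⇒x-y≈0 (trans (*-congˡ (g0 cs le)) (zeroʳ _))
        (lap-vanishes-zero′ Z m r0 (prepend-false Z m eq g0) cs le)

  ε-vanishes : ∀ {Z : E → Bool} → VanishesFrom Z 1 ε
  ε-vanishes (_ ∷ _) _ = refl

  -- Each row consumes one column, hence at most one of kind `Z`, and leaves too many of them to
  -- `g`.
  laps-vanishes : ∀ {Z : E → Bool} (rs : List (E → Carrier)) {g k} →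
    VanishesFrom Z k g → VanishesFrom Z (length rs + k) (laps rs g)
  laps-vanishes [] g0 = g0
  laps-vanishes {Z = Z} (r ∷ rs) g0 = lap-vanishes′ Z 0 (laps-vanishes {Z = Z} rs g0)

  ZeroOn : (E → Bool) → (E → Carrier) → Set _
  ZeroOn Z r = ∀ c → Z c ≡ true → r c ≈ 0#

  -- A row that is zero on `Z` contributes nothing when it takes such a column, so the threshold
  -- does not move.
  laps-vanishes-zero : ∀ {Z : E → Bool} {rs : List (E → Carrier)} {g k} → All (ZeroOn Z) rs →
    VanishesFrom Z k g → VanishesFrom Z k (laps rs g)
  laps-vanishes-zero [] g0 = g0
  laps-vanishes-zero {Z = Z} (r0 ∷ rs0) g0 = lap-vanishes-zero′ Z 0 r0 (laps-vanishes-zero {Z = Z} rs0 g0)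

  -- Block triangular determinants

  lap-++ : ∀ {r : E → Carrier} {g} cs ds → (∀ l → g (cs ++ l) ≈ 0#) →
    lap r g (cs ++ ds) ≈ lap r (λ l → g (l ++ ds)) cs
  lap-++ [] ds g0 = lap-zero g0 ds
  lap-++ (c ∷ cs) ds g0 = +-congˡ (*-congˡ (lap-++ cs ds g0))

  lap-cong-minors : ∀ {p} {P : E → Set p} {r : E → Carrier} {g g′} {cs} → All P cs →
    (∀ l → All P l → suc (length l) ≡ length cs → g l ≈ g′ l) → lap r g cs ≈ lap r g′ cs
  lap-cong-minors [] g≈ = refl
  lap-cong-minors {cs = c ∷ cs} (pc ∷ pcs) g≈ = +-cong (*-congˡ (g≈ cs pcs ≡.refl))
    (*-congˡ (lap-cong-minors pcs (λ l pl eq → g≈ (c ∷ l) (pc ∷ pl) (cong suc eq))))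

  -- Since `g` tolerates no column of kind `Z`, the rows `rs` must consume all of `cs`; being
  -- equally many, they consume nothing else, and `g` receives exactly `ds`.
  laps-block : ∀ {Z : E → Bool} (rs : List (E → Carrier)) {g} → VanishesFrom Z 1 g →
    ∀ cs ds → All (λ c → Z c ≡ true) cs → length cs ≡ length rs →
    laps rs g (cs ++ ds) ≈ g ds · D rs cs
  laps-block [] g0 [] ds zs eq = sym (*-identityʳ _)
  laps-block {Z = Z} (r ∷ rs) {g} g0 cs ds zs eq = begin
    lap r (laps rs g) (cs ++ ds)        ≈⟨ lap-++ cs ds vanish ⟩
    lap r (λ l → laps rs g (l ++ ds)) cs
      ≈⟨ lap-cong-minors zs (λ l zl eq′ → laps-block {Z = Z} rs g0 l ds zl (ℕ.suc-injective (≡.trans eq′ eq))) ⟩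
    lap r (λ l → g ds · D rs l) cs      ≈⟨ lap-scale (g ds) cs ⟩
    g ds · lap r (D rs) cs              ∎
    where
    vanish : ∀ l → laps rs g (cs ++ l) ≈ 0#
    vanish l = laps-vanishes {Z = Z} rs g0 (cs ++ l) (ℕ.≤-trans
      (ℕ.≤-reflexive (≡.trans (ℕ.+-comm (length rs) 1) (≡.trans (≡.sym eq) (cong length (≡.sym (keep-all zs))))))
      (ℕ.≤-trans (ℕ.m≤m+n _ (count Z l)) (ℕ.≤-reflexive
        (≡.sym (≡.trans (cong length (keep-++ Z cs l)) (List.length-++ (keep Z cs)))))))

  D-block : ∀ {Z : E → Bool} (rs : List (E → Carrier)) {ss} → All (ZeroOn Z) ss →
    ∀ cs ds → All (λ c → Z c ≡ true) cs → length cs ≡ length rs →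
    D (rs ++ ss) (cs ++ ds) ≈ D rs cs · D ss ds
  D-block {Z = Z} rs {ss} ss0 cs ds zs eq = trans (reflexive (laps-++ rs ss ε (cs ++ ds)))
    (trans (laps-block {Z = Z} rs (laps-vanishes-zero {Z = Z} ss0 (ε-vanishes {Z = Z})) cs ds zs eq) (*-comm _ _))

  -- Vandermonde determinants

  x·y≈0⇒y≈0 : ∀ {x y} → ¬ (x ≈ 0#) → x · y ≈ 0# → y ≈ 0#
  x·y≈0⇒y≈0 {x} {y} x≉0 xy≈0 = begin
    y                ≈⟨ *-identityˡ y ⟨
    1# · y           ≈⟨ *-congʳ (⁻¹-inverse x x≉0) ⟨
    (x · x ⁻¹) · y   ≈⟨ solve 3 (λ x i y → (x :* i) :* y := i :* (x :* y)) refl x (x ⁻¹) y ⟩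
    x ⁻¹ · (x · y)   ≈⟨ *-congˡ xy≈0 ⟩
    x ⁻¹ · 0#        ≈⟨ zeroʳ _ ⟩
    0#               ∎

  x-y≈0⇒x≈y : ∀ {x y} → x ⊕ -1# · y ≈ 0# → x ≈ y
  x-y≈0⇒x≈y {x} {y} eq = begin
    x                    ≈⟨ +-identityʳ x ⟨
    x ⊕ 0#               ≈⟨ +-congˡ (x-x≈0 y) ⟨
    x ⊕ (y ⊕ -1# · y)    ≈⟨ solve 3 (λ x y z → x :+ (y :+ z) := (x :+ z) :+ y) refl x y _ ⟩
    (x ⊕ -1# · y) ⊕ y    ≈⟨ +-congʳ eq ⟩
    0# ⊕ y               ≈⟨ +-identityˡ y ⟩
    y                    ∎

  ·-cancel : ∀ {u v w} → u ≉ 0# → u · v ≈ u · w → v ≈ w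
  ·-cancel {u} {v} {w} u≉0 eq = x-y≈0⇒x≈y (x·y≈0⇒y≈0 u≉0 (begin
    u · (v ⊕ -1# · w)       ≈⟨ solve 4 (λ u v m w → u :* (v :+ m :* w) := u :* v :+ m :* (u :* w)) refl u v -1# w ⟩
    u · v ⊕ -1# · (u · w)   ≈⟨ +-congʳ eq ⟩
    u · w ⊕ -1# · (u · w)   ≈⟨ x-x≈0 _ ⟩
    0#                      ∎))

  -- Coefficients are listed from the leading one downwards.
  poly : List Carrier → Carrier → Carrier
  poly [] y = 0#
  poly (k ∷ ks) y = k · y ^ length ks ⊕ poly ks y

  -- Synthetic division of poly (k ∷ ks) by y - r.
  divide : Carrier → Carrier → List Carrier → List Carrier
  divide r k [] = []
  divide r k (l ∷ ks) = k ∷ divide r (l ⊕ r · k) ks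

  remainder : Carrier → Carrier → List Carrier → Carrier
  remainder r k [] = k
  remainder r k (l ∷ ks) = remainder r (l ⊕ r · k) ks

  length-divide : ∀ r k ks → length (divide r k ks) ≡ length ks
  length-divide r k [] = ≡.refl
  length-divide r k (l ∷ ks) = cong suc (length-divide r _ ks)

  poly-divide : ∀ r k ks y →
    poly (k ∷ ks) y ≈ (y ⊕ -1# · r) · poly (divide r k ks) y ⊕ remainder r k ks
  poly-divide r k [] y = begin
    k · 1# ⊕ 0#                       ≈⟨ trans (+-identityʳ _) (*-identityʳ k) ⟩
    k                                 ≈⟨ +-identityˡ k ⟨
    0# ⊕ k                            ≈⟨ +-congʳ (zeroʳ _) ⟨
    (y ⊕ -1# · r) · 0# ⊕ k            ∎
  poly-divide r k (l ∷ ks) y = begin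
    k · (y · Y) ⊕ (l · Y ⊕ poly ks y)
      ≈⟨ +-identityʳ _ ⟨
    (k · (y · Y) ⊕ (l · Y ⊕ poly ks y)) ⊕ 0#
      -- The solver works over semirings with `-1#` as an opaque variable, so the cancelling pair is
      -- introduced by hand.
      ≈⟨ +-congˡ (x-x≈0 ((r · k) · Y)) ⟨
    (k · (y · Y) ⊕ (l · Y ⊕ poly ks y)) ⊕ ((r · k) · Y ⊕ -1# · ((r · k) · Y))
      ≈⟨ solve 7 (λ k y Y l P r m → (k :* (y :* Y) :+ (l :* Y :+ P)) :+ ((r :* k) :* Y :+ m :* ((r :* k) :* Y))
           := (y :+ m :* r) :* (k :* Y) :+ ((l :+ r :* k) :* Y :+ P)) refl k y Y l _ r -1# ⟩
    (y ⊕ -1# · r) · (k · Y) ⊕ poly (l ⊕ r · k ∷ ks) y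
      ≈⟨ +-congˡ (poly-divide r _ ks y) ⟩
    (y ⊕ -1# · r) · (k · Y) ⊕ ((y ⊕ -1# · r) · Q ⊕ R)
      ≈⟨ solve 4 (λ d k q r → d :* k :+ (d :* q :+ r) := d :* (k :+ q) :+ r) refl _ _ _ _ ⟩
    (y ⊕ -1# · r) · (k · Y ⊕ Q) ⊕ R
      ≡⟨ cong (λ n → (y ⊕ -1# · r) · (k · y ^ n ⊕ Q) ⊕ R) (length-divide r _ ks) ⟨
    (y ⊕ -1# · r) · (k · y ^ length (divide r (l ⊕ r · k) ks) ⊕ Q) ⊕ R ∎
    where
    Y = y ^ length ks
    Q = poly (divide r (l ⊕ r · k) ks) y
    R = remainder r (l ⊕ r · k) ks

  poly-factor : ∀ {r k ks} → poly (k ∷ ks) r ≈ 0# → ∀ y →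
    poly (k ∷ ks) y ≈ (y ⊕ -1# · r) · poly (divide r k ks) y
  poly-factor {r} {k} {ks} root y = trans (poly-divide r k ks y) (trans (+-congˡ rem≈0) (+-identityʳ _))
    where
    rem≈0 : remainder r k ks ≈ 0#
    rem≈0 = begin
      remainder r k ks ≈⟨ +-identityˡ _ ⟨
      0# ⊕ remainder r k ks ≈⟨ +-congʳ (trans (*-congʳ (x-x≈0 r)) (zeroˡ _)) ⟨
      (r ⊕ -1# · r) · poly (divide r k ks) r ⊕ remainder r k ks ≈⟨ poly-divide r k ks r ⟨
      poly (k ∷ ks) r ≈⟨ root ⟩
      0# ∎

  -- A polynomial has no more roots than its degree: dividing out a root keeps the leading
  -- coefficient `k` and the remaining roots, until the constant `k` is left.
  poly-nonzero : ∀ {k ks rs} y → k ≉ 0# → length ks ≡ length rs → AllPairs _≉_ rs →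
    All (λ r → poly (k ∷ ks) r ≈ 0#) rs → All (y ≉_) rs → poly (k ∷ ks) y ≉ 0#
  poly-nonzero {ks = []} y k≉0 _ _ _ _ eq = k≉0 (trans (sym (trans (+-identityʳ _) (*-identityʳ _))) eq)
  poly-nonzero {k} {l ∷ ks} {r ∷ rs} y k≉0 len (r≉rs ∷ rs≉) (root ∷ roots) (y≉r ∷ y≉rs) eq =
    poly-nonzero {k} {divide r (l ⊕ r · k) ks} {rs} y k≉0
      (≡.trans (length-divide r _ ks) (ℕ.suc-injective len)) rs≉
      (All.zipWith (λ { {s} (r≉s , root′) → x·y≈0⇒y≈0 (r≉s ∘ sym ∘ x-y≈0⇒x≈y) (trans (sym (poly-factor {ks = l ∷ ks} root s)) root′) }) (r≉rs , roots))
      y≉rs (x·y≈0⇒y≈0 (y≉r ∘ x-y≈0⇒x≈y) (trans (sym (poly-factor {ks = l ∷ ks} root y)) eq))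

  -- The signed cofactors along the first row, that is, the coefficients of the determinant as a
  -- polynomial in the variable of that row.
  lap-coefficients : Functional ℕ → ℕ → List Carrier
  lap-coefficients g zero = []
  lap-coefficients g (suc m) = g (downFrom m) ∷ map (-1# ·_) (lap-coefficients (g ∘ (m ∷_)) m)

  length-lap-coefficients : ∀ g m → length (lap-coefficients g m) ≡ m
  length-lap-coefficients g zero = ≡.refl
  length-lap-coefficients g (suc m) = cong suc (≡.trans (List.length-map _ (lap-coefficients (g ∘ (m ∷_)) m)) (length-lap-coefficients _ m))

  poly-map : ∀ k ks y → poly (map (k ·_) ks) y ≈ k · poly ks y
  poly-map k [] y = sym (zeroʳ k)
  poly-map k (l ∷ ks) y = trans (+-cong (*-congˡ (reflexive (cong (y ^_) (List.length-map (k ·_) ks)))) (poly-map k ks y))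
    (solve 4 (λ k l Y p → (k :* l) :* Y :+ k :* p := k :* (l :* Y :+ p)) refl k l _ _)

  lap-poly : ∀ g m y → lap (pow y) g (downFrom m) ≈ poly (lap-coefficients g m) y
  lap-poly g zero y = refl
  lap-poly g (suc m) y = +-cong
    (trans (*-comm _ _) (*-congˡ (reflexive (cong (y ^_) (≡.sym (ℕ.suc-injective (length-lap-coefficients g (suc m))))))))
    (trans (*-congˡ (lap-poly (g ∘ (m ∷_)) m y)) (sym (poly-map -1# (lap-coefficients (g ∘ (m ∷_)) m) y)))

  -- As a polynomial in `y`, the determinant has degree `length ys`, the Vandermonde determinant of
  -- `ys` as leading coefficient, and the entries of `ys` as roots, because these repeat a row.
  vandermonde-nonzero : ∀ {ys} → AllPairs _≉_ ys → D (map pow ys) (downFrom (length ys)) ≉ 0#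
  vandermonde-nonzero [] eq = 0≉1 (sym eq)
  vandermonde-nonzero {y ∷ ys} (y≉ys ∷ ys≉) eq =
    poly-nonzero {ks = map (-1# ·_) (lap-coefficients (λ l → D (map pow ys) (length ys ∷ l)) (length ys))} {ys} y (vandermonde-nonzero ys≉)
      (ℕ.suc-injective (length-lap-coefficients (D (map pow ys)) (suc (length ys)))) ys≉
      (All.tabulate (λ {r} r∈ys → trans (sym (lap-poly (D (map pow ys)) (suc (length ys)) r))
        (repeated⇒0 {g = λ rs → laps rs ε (downFrom (suc (length ys)))} (rows-swap ε _) (rows-repeat ε _) (∈-map⁺ pow r∈ys))))
      y≉ys (trans (sym (lap-poly (D (map pow ys)) (suc (length ys)) y)) eq)

  alternant-nonzero : ∀ {ys} → AllPairs _≉_ ys → alternant ys [] ≉ 0#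
  alternant-nonzero {ys} distinct eq = vandermonde-nonzero distinct
    (trans (reflexive (cong (D (map pow ys)) (≡.sym (exponents-[] (length ys))))) (trans (sym (alternant-D ys [])) eq))

-- The alternant in the variables (X, ωX, ..., ω^(t-1)X, 1)

module Factorisation {a ℓ} (F : Field a ℓ) (t n : ℕ) .{{nz : NonZero t}} (ω : Field.Carrier F)
    (prim : FieldOps.Primitive F t ω) (x : Fin n → Field.Carrier F) where
  open FieldOps F
  open Determinant F
  open Residues t
  open import Relation.Binary.Reasoning.Setoid setoid
  open import Algebra.Solver.Ring.NaturalCoefficients.Default commutativeSemiring
    using (solve; _:=_; _:*_)

  row : ℕ → Carrier → ℕ → Carrier
  row i y e = if (e % t) ≡ᵇ i then y ^ e else 0#

  rows : ℕ → List (ℕ → Carrier)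
  rows i = map (λ b → row i (x b)) (allFin n)

  one : List (ℕ → Carrier)
  one = pow 1# ∷ []

  indices : List (ℕ × Fin n)
  indices = cartesianProduct (upTo t) (allFin n)

  node : ℕ × Fin n → Carrier
  node (i , b) = ω ^ i · x b

  -- The Kronecker product of the Fourier matrix (ω^(ij)) with the identity matrix of size n.
  fourier : ℕ × Fin n → ℕ × Fin n → Carrier
  fourier (i , b) (j , b′) = if does (b Fin.≟ b′) then ω ^ (i * j) else 0#

  row-∈ : ∀ {i} y {e} → (e % t ≡ᵇ i) ≡ true → row i y e ≈ y ^ e
  row-∈ y eq rewrite eq = refl

  row-∉ : ∀ {i} y {e} → (e % t ≡ᵇ i) ≡ false → row i y e ≈ 0#
  row-∉ y eq rewrite eq = refl

  ω^-% : ∀ e → ω ^ e ≈ ω ^ (e % t)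
  ω^-% e = begin
    ω ^ e                                ≡⟨ cong (ω ^_) (ℕ.m≡m%n+[m/n]*n e t) ⟩
    ω ^ (e % t + e / t * t)              ≈⟨ ^-+ ω (e % t) _ ⟩
    ω ^ (e % t) · ω ^ (e / t * t)        ≈⟨ *-congˡ (trans (^-* ω (e / t) t) (trans (^-cong (e / t) (proj₁ prim)) (1^ (e / t)))) ⟩
    ω ^ (e % t) · 1#                     ≈⟨ *-identityʳ _ ⟩
    ω ^ (e % t)                          ∎

  -- Sorting the monomials by residue: a discrete Fourier transform in the rows.
  pow-fourier : ∀ k e → pow (node k) e ≈ combine indices (λ { (i , b) → row i (x b) }) (fourier k) e
  pow-fourier (i , b) e = sym (trans
    (sumOver-single {k = e % t , b} (Unique.cartesianProduct⁺ (Unique.upTo⁺ t) (Unique.allFin⁺ n))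
      (∈-cartesianProduct⁺ (∈-upTo⁺ (ℕ.m%n<n e t)) (∈-allFin b)) off)
    diagonal)
    where
    off : ∀ k → k ≢ (e % t , b) → fourier (i , b) k · row (proj₁ k) (x (proj₂ k)) e ≈ 0#
    off (j , b′) k≢ with b Fin.≟ b′
    ... | no _ = zeroˡ _
    ... | yes ≡.refl = trans (*-congˡ (row-∉ (x b) (≡ᵇ-false (λ eq → k≢ (cong (_, b) (≡.sym eq)))))) (zeroʳ _)
    diagonal : fourier (i , b) (e % t , b) · row (e % t) (x b) e ≈ (ω ^ i · x b) ^ e
    diagonal with b Fin.≟ b
    ... | no b≢b = ⊥-elim (b≢b ≡.refl)
    ... | yes _ = begin
      ω ^ (i * (e % t)) · row (e % t) (x b) e  ≈⟨ *-cong (^-* ω i (e % t)) (row-∈ (x b) (≡ᵇ-true {e % t} ≡.refl)) ⟩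
      (ω ^ (e % t)) ^ i · x b ^ e             ≈⟨ *-congʳ (^-cong i (ω^-% e)) ⟨
      (ω ^ e) ^ i · x b ^ e                   ≈⟨ *-congʳ (^-* ω i e) ⟨
      ω ^ (i * e) · x b ^ e                   ≡⟨ cong (λ k → ω ^ k · x b ^ e) (ℕ.*-comm i e) ⟩
      ω ^ (e * i) · x b ^ e                   ≈⟨ *-congʳ (^-* ω e i) ⟩
      (ω ^ i) ^ e · x b ^ e                   ≈⟨ ·-^ (ω ^ i) (x b) e ⟨
      (ω ^ i · x b) ^ e                       ∎

  spec≡ : spec t n ω x ≡ map node indices ++ 1# ∷ []
  spec≡ = cong (_++ 1# ∷ []) (≡.sym (map-cartesianProduct node (upTo t) (allFin n)))

  DFT : Carrier
  DFT = D (map fourier indices) indices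

  D-spec : ∀ B → D (map pow (spec t n ω x)) B ≈ DFT · D (concatMap rows (upTo t) ++ one) B
  D-spec B = begin
    D (map pow (spec t n ω x)) B
      ≡⟨ cong (λ ys → D (map pow ys) B) spec≡ ⟩
    D (map pow (map node indices ++ 1# ∷ [])) B
      ≡⟨ cong (λ rs → D rs B) (≡.trans (List.map-++ pow (map node indices) _) (cong (_++ one) (≡.sym (List.map-∘ indices)))) ⟩
    D (map (pow ∘ node) indices ++ one) B
      ≡⟨ laps-++ (map (pow ∘ node) indices) one ε B ⟩
    laps (map (pow ∘ node) indices) (D one) B
      ≈⟨ laps-cong pow-fourier indices (D one) B ⟩
    laps (map (combine indices N ∘ fourier) indices) (D one) B
      ≡⟨ cong (λ rs → laps rs (D one) B) (List.map-∘ indices) ⟩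
    laps (map (combine indices N) (map fourier indices)) (D one) B
      ≈⟨ laps-multiplicative indices N (map fourier indices) (D one) B (≡.sym (List.length-map fourier indices)) ⟩
    DFT · laps (map N indices) (D one) B
      ≡⟨ cong (λ rs → DFT · laps rs (D one) B) (map-cartesianProduct N (upTo t) (allFin n)) ⟩
    DFT · laps (concatMap rows (upTo t)) (D one) B
      ≡⟨ cong (DFT ·_) (laps-++ (concatMap rows (upTo t)) one ε B) ⟨
    DFT · D (concatMap rows (upTo t) ++ one) B ∎
    where
    N : ℕ × Fin n → ℕ → Carrier
    N (i , b) = row i (x b)

  -- Vanishing for long cores

  length-rows : ∀ i → length (rows i) ≡ n
  length-rows i = ≡.trans (List.length-map (λ b → row i (x b)) (allFin n)) (List.length-tabulate id)

  -- Columns whose residue lies in `z` can be consumed only by the n rows of each residue in `z`;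
  -- all other rows vanish on them.
  rows-vanish : ∀ (z : ℕ → Bool) L {g k} → VanishesFrom (z ∘ (_% t)) k g →
    VanishesFrom (z ∘ (_% t)) (count z L * n + k) (laps (concatMap rows L) g)
  rows-vanish z [] g0 = g0
  rows-vanish z (i ∷ L) {g} {k} g0 l le rewrite laps-++ (rows i) (concatMap rows L) g l with z i in zi
  ... | true = laps-vanishes {Z = z ∘ (_% t)} (rows i) (rows-vanish z L g0) l
    (ℕ.≤-trans (ℕ.≤-reflexive (≡.trans (cong (_+ (count z L * n + k)) (length-rows i)) (≡.sym (ℕ.+-assoc n _ k)))) le)
  ... | false = laps-vanishes-zero {Z = z ∘ (_% t)} {rs = rows i} (All.map⁺ (All.tabulate λ {b} _ → λ e ze → row-∉ (x b) (off e ze)))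
      (rows-vanish z L g0) l le
    where
    off : ∀ e → z (e % t) ≡ true → (e % t ≡ᵇ i) ≡ false
    off e ze = ≡ᵇ-false {e % t} {i} (λ eq → contradiction (≡.trans (≡.sym ze) (≡.trans (cong z eq) zi)) (λ ()))

  -- The `2` consists of one column for the row of ones and one in excess.
  D-vanish : ∀ (z : ℕ → Bool) B → count z (upTo t) * n + 2 ≤ count (z ∘ (_% t)) B → D (concatMap rows (upTo t) ++ one) B ≈ 0#
  D-vanish z B le = trans (reflexive (laps-++ (concatMap rows (upTo t)) one ε B))
    (rows-vanish z (upTo t) (laps-vanishes {Z = z ∘ (_% t)} one (ε-vanishes {Z = z ∘ (_% t)})) B le)

  count≤ : ∀ (z : ℕ → Bool) S → (∀ i → z i ≡ true → i ∈ S) → count z (upTo t) ≤ length S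
  count≤ z S z⊆S = unique-⊆⇒length≤ (AllPairs-keep⁺ z (Unique.upTo⁺ t)) (λ {i} i∈ → z⊆S i (All.lookup (keep-satisfies z (upTo t)) i∈))

  tn≤e⇒n≤e/t : ∀ {e} → t * n ≤ e → n ≤ e / t
  tn≤e⇒n≤e/t {e} tn≤e = subst (_≤ e / t) (≡.trans (cong (_/ t) (ℕ.*-comm t n)) (ℕ.m*n/n≡m n t)) (ℕ./-monoˡ-≤ t tn≤e)

  D-long-core : ∀ {lam κ} → 1 ≤ t → length lam ≡ t * n + 1 → Decreasing lam → IsCore t lam κ → 1 < partLength κ →
    D (concatMap rows (upTo t) ++ one) (beta lam) ≈ 0#
  D-long-core {lam} {κ} 1≤t len d (reach , core) long
    with e₁ , e₂ , e₁∈ , e₂∈ , tn≤e₂ , e₂<e₁ ← long-core n κ 1≤t (≡.trans (reach-length reach) len) (reach-decreasing d reach) long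
    with e₁ % t ℕ.≟ e₂ % t
  -- On a common runner the larger number has quotient at least n + 1, so flushness yields n + 2
  -- columns of this residue.
  ... | yes r₁≡r₂ = D-vanish (_≡ᵇ e₁ % t) (beta lam) (ℕ.≤-trans
      (ℕ.+-monoˡ-≤ 2 (ℕ.*-monoˡ-≤ n (count≤ (_≡ᵇ e₁ % t) (e₁ % t ∷ []) (λ i eq → here (≡ᵇ-true⁻ eq)))))
      (ℕ.≤-trans (ℕ.≤-reflexive (rearrange n)) (ℕ.≤-trans
        (core-nRes (suc n) 1≤t (reach-decreasing d reach) core e₁∈ (ℕ.≤-<-trans (tn≤e⇒n≤e/t tn≤e₂) q₂<q₁))
        (ℕ.≤-reflexive (≡.sym (nRes-reach (e₁ % t) 1≤t reach))))))
    where
    rearrange : ∀ n → 1 * n + 2 ≡ suc (suc n)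
    rearrange = solve-∀
    q₂<q₁ : e₂ / t < e₁ / t
    q₂<q₁ = ℕ.*-cancelʳ-< t (e₂ / t) (e₁ / t) (ℕ.+-cancelˡ-< (e₂ % t) _ _
      (≡.subst₂ _<_ (ℕ.m≡m%n+[m/n]*n e₂ t) (≡.trans (ℕ.m≡m%n+[m/n]*n e₁ t) (cong (_+ e₁ / t * t) r₁≡r₂)) e₂<e₁))
  ... | no r₁≢r₂ = D-vanish z (beta lam) (ℕ.≤-trans
      (ℕ.+-monoˡ-≤ 2 (ℕ.*-monoˡ-≤ n (count≤ z (e₁ % t ∷ e₂ % t ∷ []) z⊆)))
      (ℕ.≤-trans (ℕ.≤-reflexive (rearrange n)) (ℕ.≤-trans
        (ℕ.+-mono-≤ (nRes≥ e₁∈ (ℕ.≤-trans tn≤e₂ (ℕ.<⇒≤ e₂<e₁))) (nRes≥ e₂∈ tn≤e₂))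
        (ℕ.≤-reflexive (≡.sym (count-∨ (λ b → b % t ≡ᵇ e₁ % t) (λ b → b % t ≡ᵇ e₂ % t) (beta lam) disjoint))))))
    where
    z : ℕ → Bool
    z i = (i ≡ᵇ e₁ % t) ∨ (i ≡ᵇ e₂ % t)
    z⊆ : ∀ i → z i ≡ true → i ∈ e₁ % t ∷ e₂ % t ∷ []
    z⊆ i eq with i ≡ᵇ e₁ % t in eq₁
    ... | true = here (≡ᵇ-true⁻ eq₁)
    ... | false = there (here (≡ᵇ-true⁻ eq))
    disjoint : ∀ b → (b % t ≡ᵇ e₁ % t) ≡ true → (b % t ≡ᵇ e₂ % t) ≡ false
    disjoint b eq = ≡ᵇ-false (λ eq₂ → r₁≢r₂ (≡.trans (≡.sym (≡ᵇ-true⁻ {b % t} eq)) eq₂))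
    rearrange : ∀ n → 2 * n + 2 ≡ suc n + suc n
    rearrange = solve-∀
    nRes≥ : ∀ {e} → e ∈ beta κ → t * n ≤ e → suc n ≤ nRes t (e % t) lam
    nRes≥ {e} e∈ tn≤e = ℕ.≤-trans
      (core-nRes n 1≤t (reach-decreasing d reach) core e∈ (tn≤e⇒n≤e/t tn≤e))
      (ℕ.≤-reflexive (≡.sym (nRes-reach (e % t) 1≤t reach)))

  -- The n rows of residue `c` pass the cn rows of smaller residue to reach the front; then the row
  -- of ones passes the (t-1)n rows of the other residues to join them.
  rows-arrange : ∀ {c} → c < t → ∀ B → D (concatMap rows (upTo t) ++ one) B
    ≈ sgnPow ((c * n) * n + (t ∸ 1) * n) · D ((rows c ++ one) ++ concatMap rows (others c)) B
  rows-arrange {c} c<t B = begin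
    G (concatMap rows (upTo t) ++ one)
      ≡⟨ cong (λ l → G (concatMap rows l ++ one)) (upTo≡ c<t) ⟩
    G (concatMap rows (upTo c ++ c ∷ (after c)) ++ one)
      ≡⟨ cong G (≡.trans (cong (_++ one) (List.concatMap-++ rows (upTo c) (c ∷ (after c))))
           (≡.trans (List.++-assoc pre (rows c ++ post) one) (cong (pre ++_) (List.++-assoc (rows c) post one)))) ⟩
    G (pre ++ rows c ++ post ++ one)
      ≈⟨ move-block {g = G} sw pre (rows c) (post ++ one) ⟩
    sgnPow (length pre * length (rows c)) · G (rows c ++ pre ++ post ++ one)
      ≡⟨ ≡.cong₂ (λ k l → sgnPow k · G (rows c ++ l)) (≡.cong₂ _*_ len-pre (length-rows c)) regroup ⟩
    sgnPow (c * n * n) · G (rows c ++ concatMap rows (others c) ++ one ++ [])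
      ≈⟨ *-congˡ (move-block {g = λ l → G (rows c ++ l)} (swaps-prefix {g = G} sw (rows c)) (concatMap rows (others c)) one []) ⟩
    sgnPow (c * n * n) · (sgnPow (length (concatMap rows (others c)) * 1) · G (rows c ++ one ++ concatMap rows (others c) ++ []))
      ≈⟨ *-assoc _ _ _ ⟨
    (sgnPow (c * n * n) · sgnPow (length (concatMap rows (others c)) * 1)) · G (rows c ++ one ++ concatMap rows (others c) ++ [])
      ≈⟨ *-cong (trans (*-congˡ (reflexive (cong sgnPow len-others))) (sym (^-+ -1# (c * n * n) _)))
           (reflexive (cong G (≡.trans (≡.sym (List.++-assoc (rows c) one _)) (cong ((rows c ++ one) ++_) (List.++-identityʳ _))))) ⟩
    sgnPow (c * n * n + (t ∸ 1) * n) · G ((rows c ++ one) ++ concatMap rows (others c)) ∎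
    where
    G : Functional (ℕ → Carrier)
    G rs = D rs B
    sw : Swaps G
    sw = rows-swap ε B
    pre = concatMap rows (upTo c)
    post = concatMap rows (after c)
    len-pre : length pre ≡ c * n
    len-pre = ≡.trans (length-concatMap {L = upTo c} (All.tabulate λ {i} _ → length-rows i)) (cong (_* n) (List.length-upTo c))
    len-others : length (concatMap rows (others c)) * 1 ≡ (t ∸ 1) * n
    len-others = ≡.trans (ℕ.*-identityʳ _) (≡.trans (length-concatMap {L = others c} (All.tabulate λ {i} _ → length-rows i)) (cong (_* n) (length-others c<t)))
    regroup : pre ++ post ++ one ≡ concatMap rows (others c) ++ one ++ []
    regroup = ≡.trans (≡.sym (List.++-assoc pre post one))
      (cong (_++ one) (≡.sym (≡.trans (cong (concatMap rows) (others≡ c<t)) (List.concatMap-++ rows (upTo c) (after c)))))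

  rows-ZeroOn : ∀ {i} L → All (i ≢_) L → All (ZeroOn (λ e → e % t ≡ᵇ i)) (concatMap rows L)
  rows-ZeroOn [] [] = []
  rows-ZeroOn {i} (j ∷ L) (i≢j ∷ i≢L) = All.++⁺
    (All.map⁺ {xs = allFin n} (All.tabulate λ {b} _ → λ e eq → row-∉ (x b) {e} (≡ᵇ-false {e % t} (λ eq′ → i≢j (≡.trans (≡.sym (≡ᵇ-true⁻ {e % t} eq)) eq′)))))
    (rows-ZeroOn L i≢L)

  D-diagonal : ∀ B {L} → Unique L → All (λ i → length (class i B) ≡ n) L →
    D (concatMap rows L) (concatMap (λ i → class i B) L) ≈ prod (map (λ i → D (rows i) (class i B)) L)
  D-diagonal B [] [] = refl
  D-diagonal B {i ∷ L} (i≢L ∷ uL) (len ∷ lens) = trans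
    (D-block {Z = λ e → e % t ≡ᵇ i} (rows i) (rows-ZeroOn L i≢L) (class i B) _
      (keep-satisfies _ B) (≡.trans len (≡.sym (length-rows i))))
    (*-congˡ (D-diagonal B uL lens))

  -- Diagonal blocks as determinants in the t-th powers

  powRows : List (ℕ → Carrier)
  powRows = map (λ b → pow (x b ^ t)) (allFin n)

  monomial : ℕ → Carrier
  monomial i = prod (map (λ b → x b ^ i) (allFin n))

  row-scale : ∀ i b e → (e % t ≡ᵇ i) ≡ true → row i (x b) e ≈ x b ^ i · pow (x b ^ t) (e / t)
  row-scale i b e eq = begin
    row i (x b) e                      ≈⟨ row-∈ (x b) {e} eq ⟩
    x b ^ e                            ≡⟨ cong (x b ^_) (≡.trans (ℕ.m≡m%n+[m/n]*n e t) (cong (_+ e / t * t) (≡ᵇ-true⁻ {e % t} eq))) ⟩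
    x b ^ (i + e / t * t)              ≈⟨ ^-+ (x b) i _ ⟩
    x b ^ i · x b ^ (e / t * t)        ≈⟨ *-congˡ (^-* (x b) (e / t) t) ⟩
    x b ^ i · (x b ^ t) ^ (e / t)      ∎

  D-rows : ∀ i B → D (rows i) (class i B) ≈ monomial i · D powRows (map (_/ t) (class i B))
  D-rows i B = trans
    (laps-transport {P = λ e → (e % t ≡ᵇ i) ≡ true} {h = _/ t} (λ b → x b ^ i) 1# (row-scale i)
      (λ { [] _ → sym (*-identityˡ _) ; (_ ∷ _) _ → sym (zeroʳ _) }) (allFin n) (keep-satisfies _ B))
    (*-congʳ (*-identityʳ _))

  -- The row of ones reads 1 before and after the exponents are divided by `t`, so only the n other
  -- rows release a factor.
  D-rows-one : ∀ i B → D (rows i ++ one) (class i B) ≈ monomial i · D (powRows ++ one) (map (_/ t) (class i B))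
  D-rows-one i B = begin
    D (rows i ++ one) (class i B)            ≡⟨ laps-++ (rows i) one ε (class i B) ⟩
    laps (rows i) (D one) (class i B)
      ≈⟨ laps-transport {P = λ e → (e % t ≡ᵇ i) ≡ true} {h = _/ t} (λ b → x b ^ i) (1# · 1#) (row-scale i)
           (λ l pl → lap-transport {P = λ e → (e % t ≡ᵇ i) ≡ true} {h = _/ t} 1# 1#
             (λ e _ → trans (1^ e) (sym (trans (*-identityˡ _) (1^ (e / t)))))
             (λ { [] _ → sym (*-identityˡ _) ; (_ ∷ _) _ → sym (zeroʳ _) }) pl)
           (allFin n) (keep-satisfies _ B) ⟩
    (monomial i · (1# · 1#)) · laps powRows (D one) (map (_/ t) (class i B))
      ≈⟨ *-congʳ (trans (*-congˡ (*-identityˡ 1#)) (*-identityʳ _)) ⟩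
    monomial i · laps powRows (D one) (map (_/ t) (class i B))
      ≡⟨ cong (monomial i ·_) (laps-++ powRows one ε (map (_/ t) (class i B))) ⟨
    monomial i · D (powRows ++ one) (map (_/ t) (class i B)) ∎

  -- The monomials are collected over all residues in their natural order; this product is
  -- independent of `c` and `B` and hence common to numerator and denominator.
  D-arranged : ∀ {c} → c < t → ∀ B → length (class c B) ≡ suc n → (∀ i → i < t → c ≢ i → length (class i B) ≡ n) →
    D (concatMap rows (upTo t) ++ one) (arrange c B) ≈
      sgnPow ((c * n) * n + (t ∸ 1) * n) · (prod (map monomial (upTo t)) ·
        (D (powRows ++ one) (map (_/ t) (class c B)) · prod (map (λ i → D powRows (map (_/ t) (class i B))) (others c))))
  D-arranged {c} c<t B len-c len = trans (rows-arrange c<t (arrange c B)) (*-congˡ (begin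
    D ((rows c ++ one) ++ concatMap rows L) (class c B ++ concatMap (λ i → class i B) L)
      ≈⟨ D-block {Z = λ e → e % t ≡ᵇ c} (rows c ++ one) (rows-ZeroOn L c≢L) (class c B) _ (keep-satisfies _ B)
           (≡.trans len-c (≡.sym (≡.trans (List.length-++ (rows c)) (≡.trans (cong (_+ 1) (length-rows c)) (ℕ.+-comm n 1))))) ⟩
    D (rows c ++ one) (class c B) · D (concatMap rows L) (concatMap (λ i → class i B) L)
      ≈⟨ *-cong (D-rows-one c B) (D-diagonal B uL (All.map (λ { (i<t , c≢i) → len _ i<t c≢i }) (others-∈ c))) ⟩
    (monomial c · X) · prod (map (λ i → D (rows i) (class i B)) L)
      ≈⟨ *-congˡ (trans (prod-cong {L = L} (All.tabulate (λ {i} _ → D-rows i B))) (prod-· monomial V L)) ⟩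
    (monomial c · X) · (prod (map monomial L) · prod (map V L))
      ≈⟨ solve 4 (λ m x p v → (m :* x) :* (p :* v) := (m :* p) :* (x :* v)) refl _ _ _ _ ⟩
    (monomial c · prod (map monomial L)) · (X · prod (map V L))
      ≈⟨ *-congʳ (trans (reflexive (cong (λ l → monomial c · prod (map monomial l)) (others≡ c<t)))
           (trans (prod-insert monomial (upTo c) c (after c)) (reflexive (cong (prod ∘ map monomial) (≡.sym (upTo≡ c<t)))))) ⟩
    prod (map monomial (upTo t)) · (X · prod (map V L)) ∎))
    where
    L = others c
    X = D (powRows ++ one) (map (_/ t) (class c B))
    V = λ i → D powRows (map (_/ t) (class i B))
    uL : Unique L
    uL = AllPairs-keep⁺ _ (Unique.upTo⁺ t)
    c≢L : All (c ≢_) L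
    c≢L = All.map proj₂ (others-∈ c)

  columns-sort : ∀ {c} lam → c < t → ∀ rs → D rs (beta lam) ≈ sgn (sigmaList t c lam) · D rs (arrange c (beta lam))
  columns-sort {c} lam c<t rs = begin
    D rs (beta lam)              ≡⟨ cong (D rs) (≡.trans (cong (map (at (beta lam)) ∘ upTo) (≡.sym (length-beta lam))) (map-at (beta lam))) ⟨
    g (upTo (length lam))        ≈⟨ *-identityˡ _ ⟨
    -- `sort-sign` leads from the order of σ to the natural one; the inverse direction has the same
    -- sign because sgn² = 1.
    1# · g (upTo (length lam))   ≈⟨ *-congʳ (sgnPow-double (inversions σ)) ⟨
    (sgn σ · sgn σ) · g (upTo (length lam)) ≈⟨ *-assoc _ _ _ ⟩
    sgn σ · (sgn σ · g (upTo (length lam))) ≈⟨ *-congˡ (sort-sign {g} sw (AllPairs.applyUpTo⁺₁ id (length lam) (λ i<j _ → i<j)) (sigmaList-↭ lam c<t)) ⟨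
    sgn σ · g σ                  ≡⟨ cong (λ l → sgn σ · D rs l) (map-sigmaList c lam) ⟩
    sgn σ · D rs (arrange c (beta lam)) ∎
    where
    σ = sigmaList t c lam
    g : Functional ℕ
    g l = D rs (map (at (beta lam)) l)
    sw : Swaps g
    sw p u v q = trans (reflexive (cong (D rs) (List.map-++ (at (beta lam)) p (u ∷ v ∷ q))))
      (trans (D-swaps rs (map (at (beta lam)) p) _ _ (map (at (beta lam)) q))
        (*-congˡ (reflexive (cong (D rs) (≡.sym (List.map-++ (at (beta lam)) p (v ∷ u ∷ q)))))))

  -- From n to n + 1 the new top block of t columns is interleaved with the t classes.
  downFrom-classes : ∀ {g : Functional ℕ} → Swaps g → ∀ n →
    g (downFrom (t * n)) ≈ sgnPow (triangle t * triangle (suc n)) · g (concatMap (λ i → class i (downFrom (t * n))) (upTo t))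
  downFrom-classes {g} sw zero rewrite ℕ.*-zeroʳ t | ℕ.*-zeroʳ (triangle t) | concatMap-[] {A = ℕ} {B = ℕ} (upTo t) = sym (*-identityˡ _)
  downFrom-classes {g} sw (suc n) = begin
    g (downFrom (t * suc n))
      ≡⟨ cong g (≡.trans (cong downFrom (ℕ.*-suc t n)) (downFrom-+ t (t * n))) ⟩
    g (map X (downFrom t) ++ downFrom (t * n))
      ≈⟨ downFrom-classes {λ l → g (map X (downFrom t) ++ l)} (swaps-prefix {g = g} sw (map X (downFrom t))) n ⟩
    sgnPow (triangle t * triangle (suc n)) · g (map X (downFrom t) ++ concatMap C (upTo t))
      ≡⟨ cong (λ l → sgnPow (triangle t * triangle (suc n)) · g (map X (downFrom t) ++ l)) (List.++-identityʳ _) ⟨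
    sgnPow (triangle t * triangle (suc n)) · g (map X (downFrom t) ++ concatMap C (upTo t) ++ [])
      ≈⟨ *-congˡ (interleave {g = g} sw X C n t (length-class-downFrom n) []) ⟩
    sgnPow (triangle t * triangle (suc n)) · (sgnPow (triangle t * suc n) · g (concatMap (λ i → X i ∷ C i) (upTo t) ++ []))
      ≈⟨ solve 3 (λ u v w → u :* (v :* w) := (v :* u) :* w) refl _ _ _ ⟩
    (sgnPow (triangle t * suc n) · sgnPow (triangle t * triangle (suc n))) · g (concatMap (λ i → X i ∷ C i) (upTo t) ++ [])
      ≈⟨ *-cong (trans (sym (^-+ -1# (triangle t * suc n) _)) (reflexive (cong sgnPow (≡.sym (ℕ.*-distribˡ-+ (triangle t) (suc n) (triangle (suc n)))))))
           (reflexive (cong g (≡.trans (List.++-identityʳ _)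
             (concatMap-cong-local (All.applyUpTo⁺₁ id t (λ {i} i<t → ≡.sym (class-downFrom n i i<t))))))) ⟩
    sgnPow (triangle t * triangle (suc (suc n))) · g (concatMap (λ i → class i (downFrom (t * suc n))) (upTo t)) ∎
    where
    X = t * n +_
    C = λ i → class i (downFrom (t * n))

  beta-∅ : List ℕ
  beta-∅ = t * n ∷ downFrom (t * n)

  0<t : 0 < t
  0<t = ℕ.>-nonZero⁻¹ t

  -- The largest exponent tn has residue 0 and already heads the class of 0, so only the tn columns
  -- below it are sorted.
  columns-empty : ∀ rs → D rs (downFrom (t * n + 1)) ≈ sgnPow (triangle t * triangle (suc n)) · D rs (arrange 0 beta-∅)
  columns-empty rs = begin
    D rs (downFrom (t * n + 1))   ≡⟨ cong (D rs ∘ downFrom) (ℕ.+-comm (t * n) 1) ⟩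
    D rs (t * n ∷ downFrom (t * n)) ≈⟨ downFrom-classes {λ l → D rs (t * n ∷ l)} (λ p → D-swaps rs (t * n ∷ p)) n ⟩
    sgnPow (triangle t * triangle (suc n)) · D rs (t * n ∷ concatMap C (upTo t)) ≡⟨ cong (λ l → sgnPow (triangle t * triangle (suc n)) · D rs l) same ⟩
    sgnPow (triangle t * triangle (suc n)) · D rs (arrange 0 beta-∅) ∎
    where
    C = λ i → class i (downFrom (t * n))
    same : t * n ∷ concatMap C (upTo t) ≡ arrange 0 beta-∅
    same = ≡.trans (cong (λ l → t * n ∷ concatMap C l) (upTo≡ 0<t)) (≡.cong₂ _++_ (≡.sym first)
      (≡.trans (concatMap-cong-local (All.map⁺ (All.tabulate {xs = upTo (t ∸ 1)} λ {i} _ → ≡.sym (class-row-≢ 0 n (suc i) 0<t (λ ())))))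
        (cong (concatMap (λ i → class i beta-∅)) (≡.sym (others≡ 0<t)))))
      where
      first : class 0 beta-∅ ≡ t * n ∷ C 0
      first rewrite ≡.trans (cong (_% t) (≡.sym (ℕ.+-identityʳ (t * n)))) (block-% n {0} 0<t) = ≡.refl

  class-downFrom-/ : ∀ n i → i < t → map (_/ t) (class i (downFrom (t * n))) ≡ downFrom n
  class-downFrom-/ zero i i<t rewrite ℕ.*-zeroʳ t = ≡.refl
  class-downFrom-/ (suc n) i i<t = ≡.trans (cong (map (_/ t)) (class-downFrom n i i<t))
    (≡.cong₂ _∷_ (block-/ n i<t) (class-downFrom-/ n i i<t))
    where
    block-/ : ∀ n {m} → m < t → (t * n + m) / t ≡ n
    block-/ n {m} m<t = ℕ.*-cancelʳ-≡ _ n t (ℕ.+-cancelˡ-≡ m _ _ (≡.trans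
      (≡.trans (cong (_+ (t * n + m) / t * t) (≡.sym (block-% n m<t))) (≡.sym (ℕ.m≡m%n+[m/n]*n (t * n + m) t)))
      (≡.trans (ℕ.+-comm (t * n) m) (cong (m +_) (ℕ.*-comm t n)))))

  -- Alternants of the statement as determinants `D`

  length-spec : length (spec t n ω x) ≡ t * n + 1
  length-spec = ≡.trans (List.length-++ (concatMap block (upTo t))) (cong (_+ 1)
    (≡.trans (length-concatMap {L = upTo t} (All.tabulate λ _ → ≡.trans (List.length-map _ (allFin n)) (List.length-tabulate id)))
      (cong (_* n) (List.length-upTo t))))
    where
    block : ℕ → List Carrier
    block i = map (λ b → ω ^ i · x b) (allFin n)

  length-powVars : length (powVars t n x) ≡ n
  length-powVars = ≡.trans (List.length-map _ (allFin n)) (List.length-tabulate id)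

  alternant-spec : ∀ lam → length lam ≡ t * n + 1 → alternant (spec t n ω x) lam ≈ D (map pow (spec t n ω x)) (beta lam)
  alternant-spec lam len = trans (alternant-D (spec t n ω x) lam) (reflexive (cong (D (map pow (spec t n ω x)))
    (≡.trans (cong (λ k → exponents k lam) (≡.trans length-spec (≡.sym len))) (exponents-exact lam))))

  alternant-spec-[] : alternant (spec t n ω x) [] ≈ D (map pow (spec t n ω x)) (downFrom (t * n + 1))
  alternant-spec-[] = trans (alternant-D (spec t n ω x) []) (reflexive (cong (D (map pow (spec t n ω x)))
    (≡.trans (exponents-[] (length (spec t n ω x))) (cong downFrom length-spec))))

  alternant-powVars : ∀ μ → alternant (powVars t n x) μ ≈ D powRows (exponents n μ)
  alternant-powVars μ = trans (alternant-D (powVars t n x) μ)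
    (reflexive (≡.cong₂ (λ rs k → D rs (exponents k μ)) (≡.sym (List.map-∘ (allFin n))) length-powVars))

  alternant-powVars-1 : ∀ μ → alternant (powVars t n x ++ 1# ∷ []) μ ≈ D (powRows ++ one) (exponents (suc n) μ)
  alternant-powVars-1 μ = trans (alternant-D (powVars t n x ++ 1# ∷ []) μ)
    (reflexive (≡.cong₂ (λ rs k → D rs (exponents k μ))
      (≡.trans (List.map-++ pow (powVars t n x) _) (cong (_++ one) (≡.sym (List.map-∘ (allFin n)))))
      (≡.trans (List.length-++ (powVars t n x)) (≡.trans (cong (_+ 1) length-powVars) (ℕ.+-comm n 1)))))

  -- Nonvanishing denominators and the two cases of the theorem

  module _ (x≉0 : ∀ i → x i ≉ 0#) (x-distinct : ∀ i j → x i ^ t ≈ x j ^ t → i ≡ j) (x≉1 : ∀ i → x i ^ t ≉ 1#) where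

    variable-^t : ∀ i b → (ω ^ i · x b) ^ t ≈ x b ^ t
    variable-^t i b = begin
      (ω ^ i · x b) ^ t         ≈⟨ ·-^ (ω ^ i) (x b) t ⟩
      (ω ^ i) ^ t · x b ^ t     ≈⟨ *-congʳ (^-* ω t i) ⟨
      ω ^ (t * i) · x b ^ t     ≡⟨ cong (λ k → ω ^ k · x b ^ t) (ℕ.*-comm t i) ⟩
      ω ^ (i * t) · x b ^ t     ≈⟨ *-congʳ (trans (^-* ω i t) (trans (^-cong i (proj₁ prim)) (1^ i))) ⟩
      1# · x b ^ t              ≈⟨ *-identityˡ _ ⟩
      x b ^ t                   ∎

    ω^≉0 : ∀ {i} → i < t → ω ^ i ≉ 0#
    ω^≉0 {i} i<t eq = 0≉1 (begin
      0#                      ≈⟨ zeroˡ _ ⟨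
      0# · ω ^ (t ∸ i)        ≈⟨ *-congʳ eq ⟨
      ω ^ i · ω ^ (t ∸ i)     ≈⟨ ^-+ ω i (t ∸ i) ⟨
      ω ^ (i + (t ∸ i))       ≡⟨ cong (ω ^_) (ℕ.m+[n∸m]≡n (ℕ.<⇒≤ i<t)) ⟩
      ω ^ t                   ≈⟨ proj₁ prim ⟩
      1#                      ∎)

    ω^-< : ∀ {i j} → i < j → j < t → ω ^ i ≉ ω ^ j
    ω^-< {i} {j} i<j j<t eq = proj₂ prim (j ∸ i) (ℕ.m<n⇒0<n∸m i<j) (ℕ.≤-<-trans (ℕ.m∸n≤m j i) j<t)
      (·-cancel (ω^≉0 (ℕ.<-trans i<j j<t)) (begin
        ω ^ i · ω ^ (j ∸ i)   ≈⟨ ^-+ ω i (j ∸ i) ⟨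
        ω ^ (i + (j ∸ i))     ≡⟨ cong (ω ^_) (ℕ.m+[n∸m]≡n (ℕ.<⇒≤ i<j)) ⟩
        ω ^ j                 ≈⟨ eq ⟨
        ω ^ i                 ≈⟨ *-identityʳ _ ⟨
        ω ^ i · 1#            ∎))

    ω^-injective : ∀ {i j} → i < t → j < t → ω ^ i ≈ ω ^ j → i ≡ j
    ω^-injective {i} {j} i<t j<t eq with ℕ.<-cmp i j
    ... | tri< i<j _ _ = contradiction eq (ω^-< i<j j<t)
    ... | tri≈ _ i≡j _ = i≡j
    ... | tri> _ _ j<i = contradiction (sym eq) (ω^-< j<i i<t)

    -- The t-th power forgets ω: it separates different `b` from one another and all of them from
    -- the last variable 1. For a fixed `b`, `x b` cancels and primitivity separates the powers of
    -- ω.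
    spec-distinct : AllPairs _≉_ (spec t n ω x)
    spec-distinct = subst (AllPairs _≉_) (≡.sym spec≡) (AllPairs.++⁺
      (AllPairs.map⁺ (Unique⇒AllPairs (Unique.cartesianProduct⁺ (Unique.upTo⁺ t) (Unique.allFin⁺ n)) distinct))
      ([] ∷ [])
      (All.map⁺ (All.tabulate {xs = indices} λ { {i , b} _ → (λ eq → x≉1 b (trans (sym (variable-^t i b)) (trans (^-cong t eq) (1^ t)))) ∷ [] })))
      where
      distinct : ∀ {k l} → k ∈ indices → l ∈ indices → k ≢ l → node k ≉ node l
      distinct {i , b} {j , b′} k∈ l∈ k≢l eq with x-distinct b b′ (trans (sym (variable-^t i b)) (trans (^-cong t eq) (variable-^t j b′)))
      ... | ≡.refl = k≢l (cong (_, b) (ω^-injective (bound k∈) (bound l∈)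
        (·-cancel (x≉0 b) (trans (*-comm _ _) (trans eq (*-comm _ _))))))
        where
        bound : ∀ {i b} → (i , b) ∈ indices → i < t
        bound k∈ = ∈-upTo⁻ (proj₁ (∈-cartesianProduct⁻ (upTo t) (allFin n) k∈))

    powVars-distinct : AllPairs _≉_ (powVars t n x)
    powVars-distinct = AllPairs.map⁺ (AllPairs.map (λ i≢j eq → i≢j (x-distinct _ _ eq)) (Unique.allFin⁺ n))

    powVars-1-distinct : AllPairs _≉_ (powVars t n x ++ 1# ∷ [])
    powVars-1-distinct = AllPairs.++⁺ powVars-distinct ([] ∷ []) (All.map⁺ (All.tabulate {xs = allFin n} λ {b} _ → x≉1 b ∷ []))

    schur-long-core : ∀ lam → length lam ≡ t * n + 1 → Decreasing lam → (∃ λ κ → IsCore t lam κ × 1 < partLength κ) →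
      schur (spec t n ω x) lam ≈ 0#
    schur-long-core lam len d (κ , core , long) = trans (*-congʳ (begin
      alternant (spec t n ω x) lam                            ≈⟨ alternant-spec lam len ⟩
      D (map pow (spec t n ω x)) (beta lam)                   ≈⟨ D-spec (beta lam) ⟩
      DFT · D (concatMap rows (upTo t) ++ one) (beta lam)     ≈⟨ *-congˡ (D-long-core 0<t len d core long) ⟩
      DFT · 0#                                                ≈⟨ zeroʳ _ ⟩
      0#                                                      ∎)) (zeroˡ _)

    schur-one-row : ∀ lam → length lam ≡ t * n + 1 → Decreasing lam →
      ∀ c → c < t → IsCore t lam (c ∷ replicate (t * n) 0) →
      schur (spec t n ω x) lam ≈
        (sgnPow (((t * (t ∸ 1)) / 2) * ((n * suc n) / 2) + c * n) · sgn (sigmaList t c lam))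
          · (schur (powVars t n x ++ (1# ∷ [])) (quotient t c lam)
             · prod (map (λ i → schur (powVars t n x) (quotient t i lam)) (others c)))
    schur-one-row lam len d c c<t (reach , _) = begin
      A · A₀ ⁻¹                 ≈⟨ *-congʳ A≈ ⟩
      (A₀ · R) · A₀ ⁻¹          ≈⟨ solve 3 (λ a r i → (a :* r) :* i := r :* (a :* i)) refl _ _ _ ⟩
      R · (A₀ · A₀ ⁻¹)          ≈⟨ trans (*-congˡ (⁻¹-inverse A₀ (alternant-nonzero spec-distinct))) (*-identityʳ R) ⟩
      R                         ∎
      where
      A = alternant (spec t n ω x) lam
      A₀ = alternant (spec t n ω x) []
      v = alternant (powVars t n x) []
      v′ = alternant (powVars t n x ++ 1# ∷ []) []
      V = λ i → alternant (powVars t n x) (quotient t i lam)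
      V′ = alternant (powVars t n x ++ 1# ∷ []) (quotient t c lam)
      M = prod (map monomial (upTo t))
      τ = ((t * (t ∸ 1)) / 2) * ((n * suc n) / 2)
      s = sgn (sigmaList t c lam)
      Z = prod (map (λ i → V i · v ⁻¹) (others c))
      R = (sgnPow (τ + c * n) · s) · ((V′ · v′ ⁻¹) · Z)
      w = (t ∸ 1) * n

      v≉0 : v ≉ 0#
      v≉0 = alternant-nonzero powVars-distinct

      τ≡ : triangle t * triangle (suc n) ≡ τ
      τ≡ = ≡.cong₂ _*_
        (≡.trans (cong triangle (≡.sym (ℕ.m+[n∸m]≡n 0<t))) (≡.trans (≡.sym (triangle-/2 (t ∸ 1)))
          (cong (λ k → k * (t ∸ 1) / 2) (ℕ.m+[n∸m]≡n 0<t))))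
        (≡.trans (≡.sym (triangle-/2 n)) (cong (_/ 2) (ℕ.*-comm (suc n) n)))

      nRes-c : nRes t c lam ≡ suc n
      nRes-c = ≡.trans (nRes-reach c 0<t reach) (≡.trans (cong (length ∘ class c) (beta-row c n)) (length-class-row-≡ c n c<t))

      nRes-i : ∀ i → i < t → c ≢ i → nRes t i lam ≡ n
      nRes-i i i<t c≢i = ≡.trans (nRes-reach i 0<t reach) (≡.trans (cong (length ∘ class i) (beta-row c n))
        (≡.trans (cong length (class-row-≢ c n i c<t c≢i)) (length-class-downFrom n i i<t)))

      numerator : A ≈ DFT · (s · (sgnPow (c * n * n + w) · (M · (V′ · prod (map V (others c))))))
      numerator = begin
        A                                       ≈⟨ alternant-spec lam len ⟩
        D (map pow (spec t n ω x)) (beta lam)   ≈⟨ D-spec (beta lam) ⟩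
        DFT · D (concatMap rows (upTo t) ++ one) (beta lam) ≈⟨ *-congˡ (columns-sort lam c<t (concatMap rows (upTo t) ++ one)) ⟩
        DFT · (s · D (concatMap rows (upTo t) ++ one) (arrange c (beta lam)))
          ≈⟨ *-congˡ (*-congˡ (D-arranged c<t (beta lam) nRes-c nRes-i)) ⟩
        DFT · (s · (sgnPow (c * n * n + w) · (M · (D (powRows ++ one) (map (_/ t) (betaRes t c lam))
            · prod (map (λ i → D powRows (map (_/ t) (betaRes t i lam))) (others c))))))
          ≈⟨ *-congˡ (*-congˡ (*-congˡ (*-congˡ (*-cong V′≈ (prod-cong (All.map (λ { {i} (i<t , c≢i) → V≈ i i<t c≢i }) (others-∈ c))))))) ⟨
        DFT · (s · (sgnPow (c * n * n + w) · (M · (V′ · prod (map V (others c)))))) ∎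
        where
        V′≈ : V′ ≈ D (powRows ++ one) (map (_/ t) (betaRes t c lam))
        V′≈ = trans (alternant-powVars-1 (quotient t c lam)) (reflexive (cong (D (powRows ++ one))
          (≡.trans (cong (λ k → exponents k (quotient t c lam)) (≡.sym nRes-c)) (exponents-quotient t c lam d))))
        V≈ : ∀ i → i < t → c ≢ i → V i ≈ D powRows (map (_/ t) (betaRes t i lam))
        V≈ i i<t c≢i = trans (alternant-powVars (quotient t i lam)) (reflexive (cong (D powRows)
          (≡.trans (cong (λ k → exponents k (quotient t i lam)) (≡.sym (nRes-i i i<t c≢i))) (exponents-quotient t i lam d))))

      denominator : A₀ ≈ DFT · (sgnPow τ · (sgnPow w · (M · (v′ · v ^ (t ∸ 1)))))
      denominator = begin
        A₀                                      ≈⟨ alternant-spec-[] ⟩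
        D (map pow (spec t n ω x)) (downFrom (t * n + 1)) ≈⟨ D-spec _ ⟩
        DFT · D (concatMap rows (upTo t) ++ one) (downFrom (t * n + 1)) ≈⟨ *-congˡ (columns-empty (concatMap rows (upTo t) ++ one)) ⟩
        DFT · (sgnPow (triangle t * triangle (suc n)) · D (concatMap rows (upTo t) ++ one) (arrange 0 beta-∅))
          ≈⟨ *-congˡ (*-cong (reflexive (cong sgnPow τ≡)) (D-arranged 0<t beta-∅ (length-class-row-≡ 0 n 0<t)
               (λ i i<t 0≢i → ≡.trans (cong length (class-row-≢ 0 n i 0<t 0≢i)) (length-class-downFrom n i i<t)))) ⟩
        DFT · (sgnPow τ · (sgnPow w · (M · (D (powRows ++ one) (map (_/ t) (class 0 beta-∅))
            · prod (map (λ i → D powRows (map (_/ t) (class i beta-∅))) (others 0))))))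
          ≈⟨ *-congˡ (*-congˡ (*-congˡ (*-congˡ (*-cong (sym v′≈) (trans (prod-const (All.map (λ { {i} (i<t , 0≢i) → v≈ i i<t 0≢i }) (others-∈ 0)))
               (reflexive (cong (v ^_) (length-others 0<t)))))))) ⟩
        DFT · (sgnPow τ · (sgnPow w · (M · (v′ · v ^ (t ∸ 1))))) ∎
        where
        v′≈ : v′ ≈ D (powRows ++ one) (map (_/ t) (class 0 beta-∅))
        v′≈ = trans (alternant-powVars-1 []) (reflexive (cong (D (powRows ++ one)) (≡.trans (exponents-[] (suc n)) (≡.sym class-0))))
          where
          class-0 : map (_/ t) (class 0 beta-∅) ≡ downFrom (suc n)
          class-0 rewrite ≡.trans (cong (_% t) (≡.sym (ℕ.+-identityʳ (t * n)))) (block-% n {0} 0<t) =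
            ≡.cong₂ _∷_ (≡.trans (cong (_/ t) (ℕ.*-comm t n)) (ℕ.m*n/n≡m n t)) (class-downFrom-/ n 0 0<t)
        v≈ : ∀ i → i < t → 0 ≢ i → D powRows (map (_/ t) (class i beta-∅)) ≈ v
        v≈ i i<t 0≢i = sym (trans (alternant-powVars []) (reflexive (cong (D powRows) (≡.trans (exponents-[] n)
          (≡.sym (≡.trans (cong (map (_/ t)) (class-row-≢ 0 n i 0<t 0≢i)) (class-downFrom-/ n i i<t)))))))

      -- The sign of τ comes from the denominator alone; inserting it twice supplies one copy to
      -- `A₀` and one to `R`. Replacing the exponent -cn by +cn keeps the parity.
      signs : sgnPow (c * n * n + w) ≈ (sgnPow τ · sgnPow (τ + c * n)) · sgnPow w
      signs = begin
        sgnPow (c * n * n + w)                        ≈⟨ ^-+ -1# (c * n * n) w ⟩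
        sgnPow (c * n * n) · sgnPow w                 ≈⟨ *-congʳ (sgnPow-*-square c n) ⟩
        sgnPow (c * n) · sgnPow w                     ≈⟨ *-congʳ (*-identityˡ _) ⟨
        (1# · sgnPow (c * n)) · sgnPow w              ≈⟨ *-congʳ (*-congʳ (sgnPow-double τ)) ⟨
        ((sgnPow τ · sgnPow τ) · sgnPow (c * n)) · sgnPow w ≈⟨ *-congʳ (trans (*-assoc _ _ _) (*-congˡ (sym (^-+ -1# τ (c * n))))) ⟩
        (sgnPow τ · sgnPow (τ + c * n)) · sgnPow w    ∎

      A≈ : A ≈ A₀ · R
      A≈ = begin
        A ≈⟨ numerator ⟩
        DFT · (s · (sgnPow (c * n * n + w) · (M · (V′ · prod (map V (others c))))))
          -- The alternants of the quotients become Schur polynomials times Vandermonde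
          -- determinants: one `v′` for residue `c` and t - 1 factors `v` for the others, which is
          -- what `A₀` contains.
          ≈⟨ *-congˡ (*-congˡ (*-cong signs (*-congˡ (*-cong
               (sym (trans (*-congˡ (⁻¹-inverse v′ (alternant-nonzero powVars-1-distinct))) (*-identityʳ V′)))
               (sym (trans (*-congˡ (reflexive (cong (v ^_) (≡.sym (length-others c<t))))) (prod-ratio V v≉0 (others c)))))))) ⟩
        DFT · (s · (((sgnPow τ · sgnPow (τ + c * n)) · sgnPow w) · (M · ((V′ · (v′ · v′ ⁻¹)) · (Z · v ^ (t ∸ 1))))))
          ≈⟨ solve 11 (λ K s e E r M V v i Z w → K :* (s :* (((e :* E) :* r) :* (M :* ((V :* (v :* i)) :* (Z :* w)))))
               := (K :* (e :* (r :* (M :* (v :* w))))) :* ((E :* s) :* ((V :* i) :* Z))) refl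
               DFT s (sgnPow τ) (sgnPow (τ + c * n)) (sgnPow w) M V′ v′ (v′ ⁻¹) Z (v ^ (t ∸ 1)) ⟩
        (DFT · (sgnPow τ · (sgnPow w · (M · (v′ · v ^ (t ∸ 1)))))) · R
          ≈⟨ *-congʳ denominator ⟨
        A₀ · R ∎

theorem2p7 : ∀ {a ℓ} (F : Field a ℓ) →
    let open FieldOps F in
    (t n : ℕ) → .{{_ : NonZero t}} → 2 ≤ t → 1 ≤ n →
    (ω : Carrier) → Primitive t ω →
    (x : Fin n → Carrier) →
    (∀ i → ¬ (x i ≈ 0#)) →
    (∀ i j → x i ^ t ≈ x j ^ t → i ≡ j) →
    (∀ i → ¬ (x i ^ t ≈ 1#)) →
    (lam : List ℕ) → Data.List.length lam ≡ t * n + 1 → Decreasing lam →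
    ((∃ λ κ → IsCore t lam κ × 1 < partLength κ) →
    schur (spec t n ω x) lam ≈ 0#)
    ×
    (∀ c → c < t → IsCore t lam (c ∷ replicate (t * n) 0) →
    schur (spec t n ω x) lam ≈
    ((sgnPow (((t * (t ∸ 1)) / 2) * ((n * suc n) / 2) + c * n)
    · sgn (sigmaList t c lam))
    · (schur (powVars t n x ++ (1# ∷ [])) (quotient t c lam)
    · prod (map (λ i → schur (powVars t n x) (quotient t i lam))
    (keep (λ i → not (i ≡ᵇ c)) (upTo t))))))
theorem2p7 F t n _ _ ω prim x x≉0 x-distinct x≉1 lam len d =
  schur-long-core x≉0 x-distinct x≉1 lam len d , schur-one-row x≉0 x-distinct x≉1 lam len d
  where open Factorisation F t n ω prim x
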